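{- Every finite simple graph $G=(V,E)$ is uniform-span $(2,2)$-choosable. That is: for every positive real number $a$ and every list assignment $L$ that assigns to each $z\in V\cup E$ a two-element set $L(z)=\{c_z,c_z+a\}\subset\mathbb{R}$ (all lists having the same span $a$), there exists a total weighting $w:V\cup E\to\mathbb{R}$ with $w(z)\in L(z)$ for every $z\in V\cup E$ such that for every edge $uv\in E$, $$w(u)+\sum_{e\ni u}w(e)\neq w(v)+\sum_{e\ni v}w(e).$$
   Context: For a graph $G=(V,E)$, a total weighting is a map $w:V\cup E\to\mathbb{R}$; the weighted degree of a vertex $v$ is $\sigma_w(v)=w(v)+\sum_{e\ni v}w(e)$, the sum being over edges incident to $v$. A total weighting is proper if $\sigma_w(u)\neq\sigma_w(v)$ for every edge $uv\in E$. The span of a two-element set $\{x,y\}\subset\mathbb{R}$ is $|y-x|$. A graph is uniform-span $(2,2)$-choosable if for every list assignment $L$ assigning to each element of $V\cup E$ a two-element set of reals, all of these sets having a common span, there is a proper total weighting $w$ with $w(z)\in L(z)$ for all $z\in V\cup E$. -}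

module Defs where

open import Level using (0ℓ)
open import Data.Nat using (ℕ; zero; suc)
open import Data.Fin using (Fin; zero; suc)
open import Data.Fin.Properties using (_≟_)
open import Data.Product using (_×_; _,_; proj₁; proj₂; Σ; ∃)
open import Data.Sum using (_⊎_; inj₁; inj₂)
open import Relation.Nullary using (¬_; Dec; yes; no)
open import Relation.Binary.PropositionalEquality using (_≡_)
open import Algebra.Bundles using (CommutativeRing)

-- The real numbers, axiomatised (the standard library has no reals):
-- a Dedekind-complete ordered field (with decidable equality and order,
-- which holds classically for ℝ). Every model is isomorphic to ℝ.

record RealNumbers : Set₁ where
  field
    commRing : CommutativeRing 0ℓ 0ℓ
  open CommutativeRing commRing public
  field
    0≉1     : ¬ (0# ≈ 1#)
    inverse : ∀ x → ¬ (x ≈ 0#) → Σ Carrier λ y → x * y ≈ 1#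
    _≤_        : Carrier → Carrier → Set
    ≤-resp-≈   : ∀ {x x′ y y′} → x ≈ x′ → y ≈ y′ → x ≤ y → x′ ≤ y′
    ≤-refl     : ∀ {x} → x ≤ x
    ≤-trans    : ∀ {x y z} → x ≤ y → y ≤ z → x ≤ z
    ≤-antisym  : ∀ {x y} → x ≤ y → y ≤ x → x ≈ y
    ≤-total    : ∀ x y → x ≤ y ⊎ y ≤ x
    +-mono-≤   : ∀ {x y} z → x ≤ y → (x + z) ≤ (y + z)
    *-nonneg   : ∀ {x y} → 0# ≤ x → 0# ≤ y → 0# ≤ (x * y)
    _≈?_ : ∀ x y → Dec (x ≈ y)
    _≤?_ : ∀ x y → Dec (x ≤ y)
    sup : (P : Carrier → Set) → (Σ Carrier P) →
          (Σ Carrier λ b → ∀ x → P x → x ≤ b) →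
          Σ Carrier λ s → (∀ x → P x → x ≤ s) ×
                          (∀ b → (∀ x → P x → x ≤ b) → s ≤ b)

  _<_ : Carrier → Carrier → Set
  x < y = (x ≤ y) × ¬ (x ≈ y)

record SimpleGraph : Set where
  field
    n    : ℕ
    m    : ℕ
    endpoints : Fin m → Fin n × Fin n
    loopless  : ∀ e → ¬ (proj₁ (endpoints e) ≡ proj₂ (endpoints e))
    no-multi  : ∀ e f →
      (proj₁ (endpoints e) ≡ proj₁ (endpoints f) × proj₂ (endpoints e) ≡ proj₂ (endpoints f))
      ⊎ (proj₁ (endpoints e) ≡ proj₂ (endpoints f) × proj₂ (endpoints e) ≡ proj₁ (endpoints f))
      → e ≡ f

  Element : Set
  Element = Fin n ⊎ Fin m

module _ (ℝ : RealNumbers) (G : SimpleGraph) where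
  open RealNumbers ℝ using (Carrier; _+_; 0#; _≈_)
  open SimpleGraph G

  sumFin : ∀ {k} → (Fin k → Carrier) → Carrier
  sumFin {zero}  f = 0#
  sumFin {suc k} f = f zero + sumFin (λ i → f (suc i))

  incidentWeight : (Element → Carrier) → Fin n → Fin m → Carrier
  incidentWeight w v e with v ≟ proj₁ (endpoints e) | v ≟ proj₂ (endpoints e)
  ... | yes _ | _     = w (inj₂ e)
  ... | no _  | yes _ = w (inj₂ e)
  ... | no _  | no _  = 0#

  σ : (Element → Carrier) → Fin n → Carrier
  σ w v = w (inj₁ v) + sumFin (incidentWeight w v)

  Proper : (Element → Carrier) → Set
  Proper w = ∀ e → ¬ (σ w (proj₁ (endpoints e)) ≈ σ w (proj₂ (endpoints e)))

{-# OPTIONS --safe #-}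
module Submission where

-- Dividing by the span a, only integers matter: each vertex v has an integer base b v, and 0/1 weights
-- on vertices and edges must make the totals t proper.
--
-- Which t are attainable?  With signs x : V → {-1,0,1}, an integer point t is attainable iff
--   h x = Σ_v (x_v (b_v - t_v) + x_v⁺) + Σ_{uv} (x_u + x_v)⁺ ≥ 0  for all x
-- (support functions of a zonotope); h is bisubmodular, and uncrossing lets one fix the edges one by one.
--
-- A proper attainable t is built from the top level downwards.  All unplaced vertices R share the level s,
-- and the invariant is h x ≥ #{edges inside R meeting {x = -1}} for every x that is nonpositive on R.
-- At each level an independent I ⊆ R is placed and R ∖ I drops to s - 1.  Writing η Z for the minimum of h
-- over signs that are -1 on Z and nonpositive on R, the invariant survives if I is chosen to minimise
-- cost I - η (R ∖ I), where cost I = Σ_{v ∈ R ∖ I} (1 + deg_R v): a violating sign vector is uncrossed with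
-- minimisers for η and would yield a better independent set.  Below min b the invariant forces R = ∅.

open import Defs
import Algebra.Properties.CommutativeMonoid.Sum as Sum
import Algebra.Properties.Group as GroupProperties
import Algebra.Properties.Monoid.Mult as Mult
open import Data.Bool using (Bool; true; false; not; _∧_; _∨_; if_then_else_)
import Data.Bool.Properties as Bool
open import Data.Empty using (⊥; ⊥-elim)
open import Data.Fin using (Fin; zero; suc; toℕ; fromℕ<)
open import Data.Fin.Properties using (_≟_; all?; any?; toℕ-fromℕ<; toℕ<n)
open import Data.Integer as ℤ using (ℤ; +_; -[1+_]; ∣_∣; 0ℤ; 1ℤ; -1ℤ; +≤+; -≤+)
import Data.Integer.Properties as ℤ
open import Data.Integer.Tactic.RingSolver using (solve-∀)
open import Data.List using (List; []; _∷_; allFin)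
open import Data.List.Membership.Propositional using (_∈_)
open import Data.List.Membership.Propositional.Properties using (∈-allFin)
open import Data.List.Relation.Unary.Any using (here; there)
open import Data.Nat as ℕ using (ℕ; zero; suc; z≤n; s≤s)
import Data.Nat.Properties as ℕ
open import Data.Product using (Σ; _×_; _,_; proj₁; proj₂)
open import Data.Sum using (_⊎_; inj₁; inj₂)
open import Data.Vec using (Vec; []; _∷_; lookup; tabulate)
open import Data.Vec.Properties using (lookup∘tabulate)
open import Relation.Binary using (tri<; tri≈; tri>)
open import Relation.Binary.PropositionalEquality as ≡ using (_≡_)
import Relation.Binary.Reasoning.Setoid as SetoidReasoning
open import Relation.Nullary using (¬_; Dec; yes; no; does; contradiction)
open import Relation.Nullary.Decidable using (True; toWitness; from-yes; _→-dec_; _×-dec_; _⊎-dec_)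

open Sum ℤ.+-0-commutativeMonoid using (sum; sum-cong-≗; ∑-distrib-+; ∑-comm; sum-replicate-zero)

module IntegerWeighting where

  open import Data.Integer using (_+_; _-_; _*_; -_; _≤_; _<_; _≤?_)
  open ≡ using (refl; sym; trans; cong; cong₂; subst; subst₂; module ≡-Reasoning)

  -- Finite sums of integers and exhaustive minimisation.

  0≤+ : ∀ {i j} → 0ℤ ≤ i → 0ℤ ≤ j → 0ℤ ≤ i + j
  0≤+ = ℤ.+-mono-≤

  sum-mono : ∀ {n} {f g : Fin n → ℤ} → (∀ i → f i ≤ g i) → sum f ≤ sum g
  sum-mono {zero} f≤g = ℤ.≤-refl
  sum-mono {suc n} f≤g = ℤ.+-mono-≤ (f≤g zero) (sum-mono (λ i → f≤g (suc i)))

  sum-nonneg : ∀ {n} {f : Fin n → ℤ} → (∀ i → 0ℤ ≤ f i) → 0ℤ ≤ sum f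
  sum-nonneg {zero} 0≤f = ℤ.≤-refl
  sum-nonneg {suc n} 0≤f = 0≤+ (0≤f zero) (sum-nonneg (λ i → 0≤f (suc i)))

  term≤sum : ∀ {n} {f : Fin n → ℤ} → (∀ i → 0ℤ ≤ f i) → ∀ i → f i ≤ sum f
  term≤sum {f = f} 0≤f zero =
    subst (_≤ sum f) (ℤ.+-identityʳ _) (ℤ.+-monoʳ-≤ (f zero) (sum-nonneg (λ i → 0≤f (suc i))))
  term≤sum {f = f} 0≤f (suc i) = ℤ.≤-trans (term≤sum (λ j → 0≤f (suc j)) i)
    (subst (_≤ sum f) (ℤ.+-identityˡ _) (ℤ.+-monoˡ-≤ (sum (λ j → f (suc j))) (0≤f zero)))

  sum-zero : ∀ {n} {f : Fin n → ℤ} → (∀ i → f i ≡ 0ℤ) → sum f ≡ 0ℤ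
  sum-zero {n} f≡0 = trans (sum-cong-≗ f≡0) (sum-replicate-zero n)

  𝟙 : Bool → ℤ
  𝟙 false = 0ℤ
  𝟙 true  = 1ℤ

  0≤𝟙 : ∀ x → 0ℤ ≤ 𝟙 x
  0≤𝟙 false = ℤ.≤-refl
  0≤𝟙 true  = +≤+ z≤n

  δ : ∀ {n} → Fin n → Fin n → ℤ
  δ zero    zero    = 1ℤ
  δ zero    (suc j) = 0ℤ
  δ (suc i) zero    = 0ℤ
  δ (suc i) (suc j) = δ i j

  δ-refl : ∀ {n} (i : Fin n) → δ i i ≡ 1ℤ
  δ-refl zero    = refl
  δ-refl (suc i) = δ-refl i

  0≤δ : ∀ {n} (i j : Fin n) → 0ℤ ≤ δ i j
  0≤δ zero    zero    = +≤+ z≤n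
  0≤δ zero    (suc j) = ℤ.≤-refl
  0≤δ (suc i) zero    = ℤ.≤-refl
  0≤δ (suc i) (suc j) = 0≤δ i j

  sum-δ : ∀ {n} (i : Fin n) (f : Fin n → ℤ) → sum (λ j → δ i j * f j) ≡ f i
  sum-δ zero f = trans (cong₂ _+_ (ℤ.*-identityˡ (f zero)) (sum-zero (λ j → ℤ.*-zeroˡ (f (suc j)))))
                       (ℤ.+-identityʳ (f zero))
  sum-δ (suc i) f = trans (cong₂ _+_ (ℤ.*-zeroˡ (f zero)) (sum-δ i (λ j → f (suc j))))
                          (ℤ.+-identityˡ (f (suc i)))

  argmin-Fin : ∀ {k} (f : Fin (suc k) → ℤ) → Σ (Fin (suc k)) λ i → ∀ j → f i ≤ f j
  argmin-Fin {zero} f = zero , λ { zero → ℤ.≤-refl }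
  argmin-Fin {suc k} f with argmin-Fin (λ i → f (suc i))
  ... | i , fi≤ with ℤ.≤-total (f zero) (f (suc i))
  ...   | inj₁ f0≤ = zero , λ { zero → ℤ.≤-refl ; (suc j) → ℤ.≤-trans f0≤ (fi≤ j) }
  ...   | inj₂ ≤f0 = suc i , λ { zero → ≤f0 ; (suc j) → fi≤ j }

  -- Sign vectors and vertex sets are minimised over as `Vec`s and read back through `lookup`; the
  -- minimum is taken over the tail first, for each possible head.
  argmin-Vec : ∀ {k} n (f : Vec (Fin (suc k)) n → ℤ) → Σ _ λ xs → ∀ ys → f xs ≤ f ys
  argmin-Vec zero f = [] , λ { [] → ℤ.≤-refl }
  argmin-Vec {k} (suc n) f =
    let tl = λ a → argmin-Vec n (λ xs → f (a ∷ xs))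
        a , fa≤ = argmin-Fin (λ a → f (a ∷ proj₁ (tl a)))
    in a ∷ proj₁ (tl a) , λ { (c ∷ ys) → ℤ.≤-trans (fa≤ c) (proj₂ (tl c) ys) }

  -- Signs and their bisubmodular calculus.

  Sign : Set
  Sign = Fin 3

  pattern neg = zero
  pattern zer = suc zero
  pattern pos = suc (suc zero)

  val : Sign → ℤ
  val neg = -1ℤ
  val zer = 0ℤ
  val pos = 1ℤ

  isPos isNeg : Sign → Bool
  isPos pos = true
  isPos _   = false
  isNeg neg = true
  isNeg _   = false

  opp : Sign → Sign → Bool
  opp neg pos = true
  opp pos neg = true
  opp _   _   = false

  infixr 7 _⊓_
  infixr 6 _⊔_

  -- Intersection and reduced union of signed sets, the two operations that define bisubmodularity.
  _⊓_ _⊔_ : Sign → Sign → Sign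
  neg ⊓ neg = neg
  pos ⊓ pos = pos
  _   ⊓ _   = zer
  zer ⊔ y   = y
  x   ⊔ zer = x
  neg ⊔ neg = neg
  pos ⊔ pos = pos
  _   ⊔ _   = zer

  -- (val x + val y)⁺
  ε : Sign → Sign → ℤ
  ε pos pos = + 2
  ε pos zer = 1ℤ
  ε zer pos = 1ℤ
  ε _   _   = 0ℤ

  defect : Sign → Sign → Sign → Sign → ℤ
  defect x y x′ y′ = (ε x y + ε x′ y′) - (ε (x ⊓ x′) (y ⊓ y′) + ε (x ⊔ x′) (y ⊔ y′))

  -- This is bisubmodularity of the edge term `ε`, a finite check over the 81 quadruples of signs.
  0≤defect : ∀ x y x′ y′ → 0ℤ ≤ defect x y x′ y′
  0≤defect = from-yes (all? λ x → all? λ y → all? λ x′ → all? λ y′ → 0ℤ ≤? defect x y x′ y′)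

  val-modular : ∀ x y → val x + val y ≡ val (x ⊓ y) + val (x ⊔ y)
  val-modular = from-yes (all? λ x → all? λ y → val x + val y ℤ.≟ val (x ⊓ y) + val (x ⊔ y))

  pos-modular : ∀ x y → 𝟙 (isPos x) + 𝟙 (isPos y)
                      ≡ 𝟙 (isPos (x ⊓ y)) + 𝟙 (isPos (x ⊔ y)) + 𝟙 (opp x y)
  pos-modular = from-yes (all? λ x → all? λ y → 𝟙 (isPos x) + 𝟙 (isPos y)
                      ℤ.≟ 𝟙 (isPos (x ⊓ y)) + 𝟙 (isPos (x ⊔ y)) + 𝟙 (opp x y))

  -- The support function `h` and its uncrossing identity.

  module Energy {n : ℕ} (b t : Fin n → ℤ) where

    -- The support function, in direction `x`, of the segment from `b v` to `b v + 1` translated by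
    -- `- t v`.
    vterm : Sign → Fin n → ℤ
    vterm x v = val x * (b v - t v) + 𝟙 (isPos x)

    module _ {m : ℕ} (end₁ end₂ : Fin m → Fin n) where

      h : (Fin n → Sign) → ℤ
      h λ′ = sum (λ v → vterm (λ′ v) v) + sum (λ e → ε (λ′ (end₁ e)) (λ′ (end₂ e)))

      h-cong : ∀ {x y} → (∀ v → x v ≡ y v) → h x ≡ h y
      h-cong x≗y = cong₂ _+_ (sum-cong-≗ (λ v → cong (λ z → vterm z v) (x≗y v)))
                             (sum-cong-≗ (λ e → cong₂ ε (x≗y (end₁ e)) (x≗y (end₂ e))))

      surplus : (x y : Fin n → Sign) → ℤ
      surplus x y = sum (λ v → 𝟙 (opp (x v) (y v)))
                  + sum (λ e → defect (x (end₁ e)) (x (end₂ e)) (y (end₁ e)) (y (end₂ e)))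

      -- An identity rather than an inequality, because `surplus` is spent later: its `opp` terms
      -- when an edge weight is fixed, and both of its sums when a level is lowered.
      uncross : ∀ x y → h x + h y ≡ (h (λ v → x v ⊓ y v) + h (λ v → x v ⊔ y v)) + surplus x y
      uncross x y = begin
          (sum vx + sum ex) + (sum vy + sum ey)
            ≡⟨ lem₁ (sum vx) (sum ex) (sum vy) (sum ey) ⟩
          (sum vx + sum vy) + (sum ex + sum ey)
            ≡⟨ cong₂ _+_ (sym (∑-distrib-+ vx vy)) (sym (∑-distrib-+ ex ey)) ⟩
          sum (λ v → vx v + vy v) + sum (λ e → ex e + ey e)
            ≡⟨ cong₂ _+_ (sum-cong-≗ vpt) (sum-cong-≗ ept) ⟩
          sum (λ v → (vi v + vu v) + o v) + sum (λ e → (ei e + eu e) + d e)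
            ≡⟨ cong₂ _+_ (split vi vu o) (split ei eu d) ⟩
          ((sum vi + sum vu) + sum o) + ((sum ei + sum eu) + sum d)
            ≡⟨ lem₂ (sum vi) (sum vu) (sum o) (sum ei) (sum eu) (sum d) ⟩
          ((sum vi + sum ei) + (sum vu + sum eu)) + (sum o + sum d) ∎
        where
        open ≡-Reasoning
        vx vy vi vu o : Fin n → ℤ
        vx v = vterm (x v) v
        vy v = vterm (y v) v
        vi v = vterm (x v ⊓ y v) v
        vu v = vterm (x v ⊔ y v) v
        o  v = 𝟙 (opp (x v) (y v))
        ex ey ei eu d : Fin m → ℤ
        ex e = ε (x (end₁ e)) (x (end₂ e))
        ey e = ε (y (end₁ e)) (y (end₂ e))
        ei e = ε (x (end₁ e) ⊓ y (end₁ e)) (x (end₂ e) ⊓ y (end₂ e))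
        eu e = ε (x (end₁ e) ⊔ y (end₁ e)) (x (end₂ e) ⊔ y (end₂ e))
        d  e = defect (x (end₁ e)) (x (end₂ e)) (y (end₁ e)) (y (end₂ e))
        lem₁ : ∀ p q r s → (p + q) + (r + s) ≡ (p + r) + (q + s)
        lem₁ = solve-∀
        lem₂ : ∀ p q r s u w → ((p + q) + r) + ((s + u) + w) ≡ ((p + s) + (q + u)) + (r + w)
        lem₂ = solve-∀
        lem₃ : ∀ p q c i j → (p * c + i) + (q * c + j) ≡ (p + q) * c + (i + j)
        lem₃ = solve-∀
        lem₄ : ∀ p q c i j k → (p + q) * c + (i + j + k) ≡ ((p * c + i) + (q * c + j)) + k
        lem₄ = solve-∀
        lem₅ : ∀ p q → p ≡ q + (p - q)
        lem₅ = solve-∀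
        split : ∀ {k} (f g i : Fin k → ℤ) →
                sum (λ j → (f j + g j) + i j) ≡ (sum f + sum g) + sum i
        split f g i = trans (∑-distrib-+ (λ j → f j + g j) i) (cong (_+ sum i) (∑-distrib-+ f g))
        vpt : ∀ v → vx v + vy v ≡ (vi v + vu v) + o v
        vpt v = trans (lem₃ (val (x v)) (val (y v)) (b v - t v) _ _)
               (trans (cong₂ (λ p q → p * (b v - t v) + q) (val-modular (x v) (y v)) (pos-modular (x v) (y v)))
                      (lem₄ (val (x v ⊓ y v)) (val (x v ⊔ y v)) (b v - t v) _ _ _))
        ept : ∀ e → ex e + ey e ≡ (ei e + eu e) + d e
        ept e = lem₅ (ex e + ey e) (ei e + eu e)

      0≤surplus : ∀ x y → 0ℤ ≤ surplus x y
      0≤surplus x y = 0≤+ (sum-nonneg (λ v → 0≤𝟙 (opp (x v) (y v))))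
        (sum-nonneg (λ e → 0≤defect (x (end₁ e)) (x (end₂ e)) (y (end₁ e)) (y (end₂ e))))

  open Energy

  -- Realising an attainable integer point by 0/1 weights.

  ≰0⇒0≤-1- : ∀ {i} → ¬ (0ℤ ≤ i) → 0ℤ ≤ -1ℤ - i
  ≰0⇒0≤-1- {i} 0≰i = ℤ.i≤j⇒0≤j-i (ℤ.i<j⇒i≤pred[j] (ℤ.≰⇒> 0≰i))

  0≰-1 : ∀ {i} → 0ℤ ≤ i → i ≡ -1ℤ → ⊥
  0≰-1 () refl

  unit : ∀ {n} → Sign → Fin n → Fin n → Sign
  unit s zero    zero    = s
  unit s zero    (suc j) = zer
  unit s (suc i) zero    = zer
  unit s (suc i) (suc j) = unit s i j

  module _ {n : ℕ} (b t : Fin n → ℤ) where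

    vterm-zer : ∀ v → vterm b t zer v ≡ 0ℤ
    vterm-zer v = trans (ℤ.+-identityʳ _) (ℤ.*-zeroˡ (b v - t v))

  sum-unit : ∀ {n} (b t : Fin n → ℤ) s i → sum (λ v → vterm b t (unit s i v) v) ≡ vterm b t s i
  sum-unit b t s zero = trans (cong (_+_ (vterm b t s zero)) (sum-zero (λ j → vterm-zer b t (suc j)))) (ℤ.+-identityʳ _)
  sum-unit b t s (suc i) = trans (cong₂ _+_ (vterm-zer b t zero) (sum-unit (λ v → b (suc v)) (λ v → t (suc v)) s i))
                                 (ℤ.+-identityˡ _)

  bit : ∀ {i} → 0ℤ ≤ i → 0ℤ ≤ 1ℤ - i → Σ Bool λ x → i ≡ 𝟙 x
  bit {+ 0} _ _ = false , refl
  bit {+ 1} _ _ = true , refl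
  bit {+ suc (suc k)} _ ()

  -- The correction at the fixed edge is at most 1, whereas a violation on each side would demand 2.
  -- The disjunction counts opposition at the two ends only once, so `surplus` bounds it even if the
  -- ends coincide.
  edge-uncross : ∀ xu xw yu yw → 1ℤ ≤ ε xu xw → 1ℤ ≤ ε yu yw - (val yu + val yw) →
    0ℤ ≤ 1ℤ - ((ε (xu ⊓ yu) (xw ⊓ yw) + ε (xu ⊔ yu) (xw ⊔ yw)) - 𝟙 (opp xu yu ∨ opp xw yw) - (val yu + val yw))
  edge-uncross = from-yes (all? λ xu → all? λ xw → all? λ yu → all? λ yw →
    (1ℤ ≤? ε xu xw) →-dec ((1ℤ ≤? ε yu yw - (val yu + val yw)) →-dec
    (0ℤ ≤? 1ℤ - ((ε (xu ⊓ yu) (xw ⊓ yw) + ε (xu ⊔ yu) (xw ⊔ yw)) - 𝟙 (opp xu yu ∨ opp xw yw) - (val yu + val yw)))))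

  ∨-bound : ∀ p q {s} → 𝟙 p ≤ s → 𝟙 q ≤ s → 𝟙 (p ∨ q) ≤ s
  ∨-bound true  q p≤ q≤ = p≤
  ∨-bound false q p≤ q≤ = q≤

  module EdgeStep {n m : ℕ} (end₁ end₂ : Fin (suc m) → Fin n) (b t : Fin n → ℤ)
    (0≤h : ∀ x → 0ℤ ≤ h b t end₁ end₂ x) where
    u w : Fin n
    u = end₁ zero
    w = end₂ zero
    e₁ e₂ : Fin m → Fin n
    e₁ e = end₁ (suc e)
    e₂ e = end₂ (suc e)
    -- The bases once the first edge has received weight 1. Both `h⁰` and `h¹` belong to the graph
    -- without that edge, its weight having been fixed to 0 and 1 respectively.
    b¹ : Fin n → ℤ
    b¹ v = b v + (δ u v + δ w v)
    h⁰ h¹ : (Fin n → Sign) → ℤ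
    h⁰ = h b t e₁ e₂
    h¹ = h b¹ t e₁ e₂

    h-split : ∀ x → h b t end₁ end₂ x ≡ h⁰ x + ε (x u) (x w)
    h-split x = lem (sum (λ v → vterm b t (x v) v)) (ε (x u) (x w)) (sum (λ e → ε (x (e₁ e)) (x (e₂ e))))
      where
      lem : ∀ p q r → p + (q + r) ≡ (p + r) + q
      lem = solve-∀

    h¹-h⁰ : ∀ x → h¹ x ≡ h⁰ x + (val (x u) + val (x w))
    h¹-h⁰ x = begin
        sum (λ v → vterm b¹ t (x v) v) + E
          ≡⟨ cong (_+ E) (sum-cong-≗ pt) ⟩
        sum (λ v → vterm b t (x v) v + (δ u v * val (x v) + δ w v * val (x v))) + E
          ≡⟨ cong (_+ E) (trans (∑-distrib-+ (λ v → vterm b t (x v) v) (λ v → δ u v * val (x v) + δ w v * val (x v)))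
             (cong (_+_ V) (trans (∑-distrib-+ (λ v → δ u v * val (x v)) (λ v → δ w v * val (x v)))
               (cong₂ _+_ (sum-δ u (λ v → val (x v))) (sum-δ w (λ v → val (x v))))))) ⟩
        (V + (val (x u) + val (x w))) + E
          ≡⟨ lem V (val (x u) + val (x w)) E ⟩
        (V + E) + (val (x u) + val (x w)) ∎
      where
      open ≡-Reasoning
      V = sum (λ v → vterm b t (x v) v)
      E = sum (λ e → ε (x (e₁ e)) (x (e₂ e)))
      lem : ∀ p q r → (p + q) + r ≡ (p + r) + q
      lem = solve-∀
      lem′ : ∀ p q r s d c → p * ((q + (r + s)) - d) + c ≡ (p * (q - d) + c) + (r * p + s * p)
      lem′ = solve-∀
      pt : ∀ v → vterm b¹ t (x v) v ≡ vterm b t (x v) v + (δ u v * val (x v) + δ w v * val (x v))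
      pt v = lem′ (val (x v)) (b v) (δ u v) (δ w v) (t v) (𝟙 (isPos (x v)))

    all-of-min : ∀ (c : Fin n → ℤ) xs → (∀ ys → h c t e₁ e₂ (lookup xs) ≤ h c t e₁ e₂ (lookup ys)) →
      0ℤ ≤ h c t e₁ e₂ (lookup xs) → ∀ x → 0ℤ ≤ h c t e₁ e₂ x
    all-of-min c xs min 0≤ x = subst (0ℤ ≤_) (h-cong c t e₁ e₂ (lookup∘tabulate x))
      (ℤ.≤-trans 0≤ (min (tabulate x)))

    -- By integrality each violation is at least 1. Uncrossing `x` with `y` under `h⁰`, and using
    -- nonnegativity of the full `h` at the meet and at the join, contradicts `edge-uncross`: the
    -- six nonnegative quantities `a₁` to `a₆` add up to -1.
    absurd : ∀ x y → ¬ 0ℤ ≤ h⁰ x → ¬ 0ℤ ≤ h¹ y → ⊥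
    absurd x y x< y< = 0≰-1 (0≤+ (0≤+ (0≤+ (0≤+ (0≤+ a₁ a₂) a₃) a₄) a₅) a₆)
        (trans (lem X Y vy I U S c ei eu) (trans (cong (λ z → (I + U + S) - 1ℤ - z) (uncross b t e₁ e₂ x y))
          (lem′ (I + U + S))))
      where
      x⊓y x⊔y : Fin n → Sign
      x⊓y v = x v ⊓ y v
      x⊔y v = x v ⊔ y v
      X = h⁰ x
      Y = h⁰ y
      I = h⁰ x⊓y
      U = h⁰ x⊔y
      S = surplus b t e₁ e₂ x y
      vy = val (y u) + val (y w)
      ei = ε (x u ⊓ y u) (x w ⊓ y w)
      eu = ε (x u ⊔ y u) (x w ⊔ y w)
      c = 𝟙 (opp (x u) (y u) ∨ opp (x w) (y w))
      a₁ : 0ℤ ≤ -1ℤ - X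
      a₁ = ≰0⇒0≤-1- x<
      a₂ : 0ℤ ≤ -1ℤ - (Y + vy)
      a₂ = subst (λ z → 0ℤ ≤ -1ℤ - z) (h¹-h⁰ y) (≰0⇒0≤-1- y<)
      split≥0 : ∀ z → 0ℤ ≤ h⁰ z + ε (z u) (z w)
      split≥0 z = subst (0ℤ ≤_) (h-split z) (0≤h z)
      a₃ : 0ℤ ≤ I + ei
      a₃ = split≥0 x⊓y
      a₄ : 0ℤ ≤ U + eu
      a₄ = split≥0 x⊔y
      opps : ∀ v → 𝟙 (opp (x v) (y v)) ≤ S
      opps v = subst (_≤ S) (ℤ.+-identityʳ _) (ℤ.+-mono-≤
        (term≤sum (λ v → 0≤𝟙 (opp (x v) (y v))) v)
        (sum-nonneg (λ e → 0≤defect (x (e₁ e)) (x (e₂ e)) (y (e₁ e)) (y (e₂ e)))))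
      a₅ : 0ℤ ≤ S - c
      a₅ = ℤ.i≤j⇒0≤j-i (∨-bound (opp (x u) (y u)) _ (opps u) (opps w))
      lemx : ∀ p q → (-1ℤ - p) + (p + q) ≡ q - 1ℤ
      lemx = solve-∀
      lemy : ∀ p v q → (-1ℤ - (p + v)) + (p + q) ≡ (q - v) - 1ℤ
      lemy = solve-∀
      a₆ : 0ℤ ≤ 1ℤ - ((ei + eu) - c - vy)
      a₆ = edge-uncross (x u) (x w) (y u) (y w)
        (ℤ.0≤i-j⇒j≤i (subst (0ℤ ≤_) (lemx X (ε (x u) (x w))) (0≤+ a₁ (split≥0 x))))
        (ℤ.0≤i-j⇒j≤i (subst (0ℤ ≤_) (lemy Y vy (ε (y u) (y w))) (0≤+ a₂ (split≥0 y))))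
      lem : ∀ X Y v I U S c ei eu →
        ((((((-1ℤ - X) + (-1ℤ - (Y + v))) + (I + ei)) + (U + eu)) + (S - c)) + (1ℤ - ((ei + eu) - c - v)))
        ≡ (I + U + S) - 1ℤ - (X + Y)
      lem = solve-∀
      lem′ : ∀ p → p - 1ℤ - p ≡ -1ℤ
      lem′ = solve-∀

  -- Induction on the edges: by `absurd`, `h⁰` and `h¹` cannot both take a negative value, so one of
  -- the weights 0 and 1 keeps the remaining function nonnegative.
  integral-point : ∀ {n} m (end₁ end₂ : Fin m → Fin n) (b t : Fin n → ℤ) →
    (∀ x → 0ℤ ≤ h b t end₁ end₂ x) →
    Σ (Fin m → Bool) λ y → Σ (Fin n → Bool) λ w →
    ∀ v → t v ≡ b v + 𝟙 (w v) + sum (λ e → 𝟙 (y e) * (δ (end₁ e) v + δ (end₂ e) v))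
  integral-point {n} zero end₁ end₂ b t 0≤h = (λ ()) , (λ v → proj₁ (w v)) , λ v →
      trans (lem (b v) (t v)) (trans (cong (_+_ (b v)) (proj₂ (w v))) (sym (ℤ.+-identityʳ _)))
    where
    lem : ∀ p q → q ≡ p + (q - p)
    lem = solve-∀
    lem⁻ : ∀ p q → -1ℤ * (p - q) + 0ℤ ≡ q - p
    lem⁻ = solve-∀
    lem⁺ : ∀ p q → 1ℤ * (p - q) + 1ℤ ≡ 1ℤ - (q - p)
    lem⁺ = solve-∀
    -- Without edges, the signed unit vectors at `v` give `0 ≤ t v - b v` and `t v - b v ≤ 1`, which
    -- leaves one bit for the vertex weight.
    at : ∀ s v → 0ℤ ≤ vterm b t s v
    at s v = subst (0ℤ ≤_) (trans (ℤ.+-identityʳ _) (sum-unit b t s v)) (0≤h (unit s v))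
    w : ∀ v → Σ Bool λ x → t v - b v ≡ 𝟙 x
    w v = bit (subst (0ℤ ≤_) (lem⁻ (b v) (t v)) (at neg v)) (subst (0ℤ ≤_) (lem⁺ (b v) (t v)) (at pos v))
  integral-point {n} (suc m) end₁ end₂ b t 0≤h = go (argmin-Vec n (λ xs → h⁰ (lookup xs))) (argmin-Vec n (λ ys → h¹ (lookup ys)))
    where
    open EdgeStep end₁ end₂ b t 0≤h
    lem₀ : ∀ p d s → p + s ≡ p + (0ℤ * d + s)
    lem₀ = solve-∀
    lem₁ : ∀ p x d s → (p + d) + x + s ≡ p + x + (1ℤ * d + s)
    lem₁ = solve-∀
    go : (Σ (Vec Sign n) λ xs → ∀ zs → h⁰ (lookup xs) ≤ h⁰ (lookup zs)) →
         (Σ (Vec Sign n) λ ys → ∀ zs → h¹ (lookup ys) ≤ h¹ (lookup zs)) →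
         Σ (Fin (suc m) → Bool) λ y → Σ (Fin n → Bool) λ w →
         ∀ v → t v ≡ b v + 𝟙 (w v) + sum (λ e → 𝟙 (y e) * (δ (end₁ e) v + δ (end₂ e) v))
    -- The sign of the minimum decides nonnegativity over all sign vectors.
    go (xs , xmin) (ys , ymin) with 0ℤ ≤? h⁰ (lookup xs) | 0ℤ ≤? h¹ (lookup ys)
    ... | yes 0≤ | _ =
      let y , x , t≡ = integral-point m e₁ e₂ b t (all-of-min b xs xmin 0≤)
      in (λ { zero → false ; (suc e) → y e }) , x , λ v → trans (t≡ v) (lem₀ (b v + 𝟙 (x v)) (δ u v + δ w v) _)
    ... | no _ | yes 0≤ =
      let y , x , t≡ = integral-point m e₁ e₂ b¹ t (all-of-min b¹ ys ymin 0≤)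
      in (λ { zero → true ; (suc e) → y e }) , x , λ v → trans (t≡ v) (lem₁ (b v) (𝟙 (x v)) (δ u v + δ w v) _)
    ... | no x< | no y< = ⊥-elim (absurd (lookup xs) (lookup ys) x< y<)

  -- Local inequalities for the exchange argument.

  ≤! : ∀ {i j} {i≤j : True (i ≤? j)} → i ≤ j
  ≤! {i≤j = i≤j} = toWitness i≤j

  slack : ∀ {i j d} → 0ℤ ≤ d → i ≤ j → i ≤ d + j
  slack {i} {j} {d} 0≤d i≤j = subst (_≤ d + j) (ℤ.+-identityˡ i) (ℤ.+-mono-≤ 0≤d i≤j)

  touch : (r r′ : Bool) → Sign → Sign → ℤ
  touch r r′ x y = 𝟙 (r ∧ r′ ∧ (isNeg x ∨ isNeg y))

  residual : (r i i′ : Bool) → Sign → Bool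
  residual r i i′ x = r ∧ not i ∧ isNeg x ∧ not i′

  -- Summed over all edges, this gives the degrees within `r` of the vertices of `r` outside the
  -- chosen set, the degree part of `cost`.
  ecost : (r r′ i i′ : Bool) → ℤ
  ecost r r′ i i′ = 𝟙 (r ∧ r′ ∧ not i) + 𝟙 (r ∧ r′ ∧ not i′)

  -- A vertex of the unplaced set r relative to the chosen set i, the competing set i′ and the sign x under test
  -- (z is the sign in the minimiser used for uncrossing): in i and dropped from i′ because x is positive there,
  -- kept in both, added to i′, blocked by i′ although x is negative, idle (x zero), or already placed.
  data View : (r i i′ : Bool) (x y : Sign) → Set where
    dropped : View true true false pos neg
    kept    : ∀ {x y} → View true true true x y
    added   : View true false true neg neg
    blocked : View true false false neg neg
    idle    : View true false false zer neg
    placed  : ∀ {x y} → View false false false x y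

  -- In terms of the sets used in `Step`, the hypotheses are `I ⊆ r`, `I′ ⊆ K ∪ Y`, `K ⊆ I′`,
  -- nonpositivity of `x` on `r ∖ I`, and negativity of the minimiser on `r ∖ K`. They exclude every
  -- configuration that has no constructor.
  view : ∀ r i i′ x z →
    (i ≡ true → r ≡ true) →
    (i′ ≡ true → (i ∧ not (isPos x)) ∨ (r ∧ not i ∧ isNeg x) ≡ true) →
    (i ∧ not (isPos x) ≡ true → i′ ≡ true) →
    (r ∧ not i ≡ true → isPos x ≡ false) →
    (r ∧ not (i ∧ not (isPos x)) ≡ true → z ≡ neg) →
    View r i i′ x z
  view false false false x z _ _ _ _ _ = placed
  view false false true x z _ i′⇒ _ _ _ = contradiction (i′⇒ refl) λ ()
  view false true i′ x z i⇒r _ _ _ _ = contradiction (i⇒r refl) λ ()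
  view true true false neg z _ _ k⇒ _ _ = contradiction (k⇒ refl) λ ()
  view true true false zer z _ _ k⇒ _ _ = contradiction (k⇒ refl) λ ()
  view true true false pos z _ _ _ _ a⇒ with refl ← a⇒ refl = dropped
  view true true true x z _ _ _ _ _ = kept
  view true false false neg z _ _ _ _ a⇒ with refl ← a⇒ refl = blocked
  view true false false zer z _ _ _ _ a⇒ with refl ← a⇒ refl = idle
  view true false false pos z _ _ _ np _ = contradiction (np refl) λ ()
  view true false true neg z _ _ _ _ a⇒ with refl ← a⇒ refl = added
  view true false true zer z _ i′⇒ _ _ _ = contradiction (i′⇒ refl) λ ()
  view true false true pos z _ i′⇒ _ _ _ = contradiction (i′⇒ refl) λ ()

  -- A dropped vertex is paid for by `opp`, since `x` is positive and `z` negative there. A blocked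
  -- vertex counts twice on the left; its second unit is paid for by `residual`, which holds for
  -- blocked vertices only.
  vertex-check : ∀ {r i i′ x z} → View r i i′ x z →
    𝟙 (r ∧ not i′) + 𝟙 (r ∧ not i ∧ isNeg x) ≤ 𝟙 (opp x z) + (𝟙 (residual r i i′ x) + 𝟙 (r ∧ not i))
  vertex-check dropped = ≤!
  vertex-check (kept {x} {z}) = 0≤+ (0≤𝟙 (opp x z)) ℤ.≤-refl
  vertex-check added = ≤!
  vertex-check blocked = ≤!
  vertex-check idle = ≤!
  vertex-check (placed {x} {z}) = 0≤+ (0≤𝟙 (opp x z)) ℤ.≤-refl

  -- Up to the links between blocked vertices and i′, every edge inside r is accounted for exactly.
  -- The only pair that needs a positive defect is dropped-idle.
  edge-check : ∀ {r i i′ x z r₁ i₁ i′₁ x₁ z₁} → View r i i′ x z → View r₁ i₁ i′₁ x₁ z₁ →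
    i ∧ i₁ ≡ false → i′ ∧ i′₁ ≡ false → ∀ {d} → 0ℤ ≤ d → d ≡ defect x x₁ z z₁ →
    (ecost r r₁ i′ i′₁ + touch (r ∧ not i) (r₁ ∧ not i₁) x x₁)
      + (𝟙 (residual r i i′ x ∧ i′₁) + 𝟙 (residual r₁ i₁ i′₁ x₁ ∧ i′))
    ≤ d + (𝟙 (r ∧ r₁ ∧ (residual r i i′ x ∨ residual r₁ i₁ i′₁ x₁)) + ecost r r₁ i i₁)
  edge-check dropped dropped () _ _ _
  edge-check dropped kept () _ _ _
  edge-check dropped added _ _ 0≤d _ = slack 0≤d ≤!
  edge-check dropped blocked _ _ 0≤d _ = slack 0≤d ≤!
  edge-check dropped idle _ _ _ refl = ≤!
  edge-check dropped placed _ _ 0≤d _ = slack 0≤d ≤!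
  edge-check kept dropped () _ _ _
  edge-check kept kept () _ _ _
  edge-check kept added _ () _ _
  edge-check kept blocked _ _ 0≤d _ = slack 0≤d ≤!
  edge-check kept idle _ _ 0≤d _ = slack 0≤d ≤!
  edge-check kept placed _ _ 0≤d _ = slack 0≤d ≤!
  edge-check added dropped _ _ 0≤d _ = slack 0≤d ≤!
  edge-check added kept _ () _ _
  edge-check added added _ () _ _
  edge-check added blocked _ _ 0≤d _ = slack 0≤d ≤!
  edge-check added idle _ _ 0≤d _ = slack 0≤d ≤!
  edge-check added placed _ _ 0≤d _ = slack 0≤d ≤!
  edge-check blocked dropped _ _ 0≤d _ = slack 0≤d ≤!
  edge-check blocked kept _ _ 0≤d _ = slack 0≤d ≤!
  edge-check blocked added _ _ 0≤d _ = slack 0≤d ≤!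
  edge-check blocked blocked _ _ 0≤d _ = slack 0≤d ≤!
  edge-check blocked idle _ _ 0≤d _ = slack 0≤d ≤!
  edge-check blocked placed _ _ 0≤d _ = slack 0≤d ≤!
  edge-check idle dropped _ _ _ refl = ≤!
  edge-check idle kept _ _ 0≤d _ = slack 0≤d ≤!
  edge-check idle added _ _ 0≤d _ = slack 0≤d ≤!
  edge-check idle blocked _ _ 0≤d _ = slack 0≤d ≤!
  edge-check idle idle _ _ 0≤d _ = slack 0≤d ≤!
  edge-check idle placed _ _ 0≤d _ = slack 0≤d ≤!
  edge-check placed dropped _ _ 0≤d _ = slack 0≤d ≤!
  edge-check placed kept _ _ 0≤d _ = slack 0≤d ≤!
  edge-check placed added _ _ 0≤d _ = slack 0≤d ≤!
  edge-check placed blocked _ _ 0≤d _ = slack 0≤d ≤!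
  edge-check placed idle _ _ 0≤d _ = slack 0≤d ≤!
  edge-check placed placed _ _ 0≤d _ = slack 0≤d ≤!

  -- Greedy maximal extension of independent sets.

  module Greedy {n m : ℕ} (end₁ end₂ : Fin m → Fin n) (loopless : ∀ e → ¬ end₁ e ≡ end₂ e) where

    Independent : (Fin n → Bool) → Set
    Independent I = ∀ e → I (end₁ e) ∧ I (end₂ e) ≡ false

    Meets : Fin n → (Fin n → Bool) → Fin m → Set
    Meets v I e = (end₁ e ≡ v × I (end₂ e) ≡ true) ⊎ (end₂ e ≡ v × I (end₁ e) ≡ true)

    meets? : ∀ v I → Dec (Σ (Fin m) (Meets v I))
    meets? v I = any? λ e → ((end₁ e ≟ v) ×-dec (I (end₂ e) Bool.≟ true))
                        ⊎-dec ((end₂ e ≟ v) ×-dec (I (end₁ e) Bool.≟ true))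

    -- Maximality is relative to the list `qs` of vertices already examined, so that the extension
    -- can be built by recursion on the list; `allFin n` then gives full maximality inside `Y`.
    record Extension (K Y : Fin n → Bool) (qs : List (Fin n)) : Set where
      field
        I       : Fin n → Bool
        indep   : Independent I
        K⊆I     : ∀ v → K v ≡ true → I v ≡ true
        I⊆K∪Y   : ∀ v → I v ≡ true → K v ∨ Y v ≡ true
        maximal : ∀ v → v ∈ qs → Y v ≡ true → I v ≡ true ⊎ Σ (Fin m) (Meets v I)

    open Extension

    insert : Fin n → (Fin n → Bool) → Fin n → Bool
    insert q I v = I v ∨ does (v ≟ q)

    insert-self : ∀ q I → insert q I q ≡ true
    insert-self q I with q ≟ q
    ... | yes _ = Bool.∨-zeroʳ (I q)
    ... | no q≢q = contradiction refl q≢q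

    insert⊇ : ∀ q I v → I v ≡ true → insert q I v ≡ true
    insert⊇ q I v Iv rewrite Iv = refl

    insert-meets : ∀ q I v → Σ (Fin m) (Meets v I) → Σ (Fin m) (Meets v (insert q I))
    insert-meets q I v (e , inj₁ (p , Ie)) = e , inj₁ (p , insert⊇ q I _ Ie)
    insert-meets q I v (e , inj₂ (p , Ie)) = e , inj₂ (p , insert⊇ q I _ Ie)

    insert-independent : ∀ q I → Independent I → ¬ Σ (Fin m) (Meets q I) → Independent (insert q I)
    insert-independent q I indep ¬meets e
      with I (end₁ e) in I₁ | I (end₂ e) in I₂ | indep e | end₁ e ≟ q | end₂ e ≟ q
    ... | true  | false | _ | _     | yes p = contradiction (e , inj₂ (p , I₁)) ¬meets
    ... | true  | false | _ | _     | no _  = refl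
    ... | false | true  | _ | yes p | _     = contradiction (e , inj₁ (p , I₂)) ¬meets
    ... | false | true  | _ | no _  | _     = refl
    ... | false | false | _ | yes p | yes p′ = contradiction (trans p (sym p′)) (loopless e)
    ... | false | false | _ | yes _ | no _  = refl
    ... | false | false | _ | no _  | _     = refl

    extend : ∀ K Y → Independent K → ∀ qs → Extension K Y qs
    extend K Y indepK [] = record
      { I = K ; indep = indepK ; K⊆I = λ _ Kv → Kv
      ; I⊆K∪Y = λ v Kv → cong (_∨ Y v) Kv ; maximal = λ _ () }
    extend K Y indepK (q ∷ qs) with extend K Y indepK qs
    ... | E with Y q in Yq | meets? q (I E)
    ...   | false | _ = record
      { I = I E ; indep = indep E ; K⊆I = K⊆I E ; I⊆K∪Y = I⊆K∪Y E
      ; maximal = λ { v (here refl) Yv → contradiction (trans (sym Yq) Yv) λ ()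
                    ; v (there v∈) Yv → maximal E v v∈ Yv } }
    ...   | true | yes meets = record
      { I = I E ; indep = indep E ; K⊆I = K⊆I E ; I⊆K∪Y = I⊆K∪Y E
      ; maximal = λ { v (here refl) Yv → inj₂ meets
                    ; v (there v∈) Yv → maximal E v v∈ Yv } }
    ...   | true | no ¬meets = record
      { I = insert q (I E)
      ; indep = insert-independent q (I E) (indep E) ¬meets
      ; K⊆I = λ v Kv → insert⊇ q (I E) v (K⊆I E v Kv)
      ; I⊆K∪Y = sub
      ; maximal = λ { v (here refl) Yv → inj₁ (insert-self q (I E))
                    ; v (there v∈) Yv → lift v (maximal E v v∈ Yv) } }
      where
      sub : ∀ v → insert q (I E) v ≡ true → K v ∨ Y v ≡ true
      sub v ins with I E v in Iv | v ≟ q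
      ... | true  | _ = I⊆K∪Y E v Iv
      ... | false | yes refl = trans (cong (K v ∨_) Yq) (Bool.∨-zeroʳ (K v))
      ... | false | no _ = contradiction ins λ ()
      lift : ∀ v → I E v ≡ true ⊎ Σ (Fin m) (Meets v (I E)) →
             insert q (I E) v ≡ true ⊎ Σ (Fin m) (Meets v (insert q (I E)))
      lift v (inj₁ Iv) = inj₁ (insert⊇ q (I E) v Iv)
      lift v (inj₂ e)  = inj₂ (insert-meets q (I E) v e)

  -- Constrained minimisers and the optimal independent set.

  true≢false : ¬ true ≡ false
  true≢false ()

  -- A retraction onto the feasible signs: negative where the second flag is set, nonpositive where
  -- the first is. Minimising after clamping turns the constrained minimum `η` into one over all
  -- vectors, and `clamp-id` shows that no feasible vector is lost.
  clamp : Bool → Bool → Sign → Sign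
  clamp r true  x   = neg
  clamp true false pos = zer
  clamp r     false x   = x

  clamp-nonpos : ∀ {r} z x → r ≡ true → isPos (clamp r z x) ≡ false
  clamp-nonpos true  x   refl = refl
  clamp-nonpos false neg refl = refl
  clamp-nonpos false zer refl = refl
  clamp-nonpos false pos refl = refl

  clamp-id : ∀ r z x → (r ≡ true → isPos x ≡ false) → (z ≡ true → x ≡ neg) → clamp r z x ≡ x
  clamp-id r true x _ x≡neg = sym (x≡neg refl)
  clamp-id true false neg _ _ = refl
  clamp-id true false zer _ _ = refl
  clamp-id true false pos np _ = contradiction (np refl) true≢false
  clamp-id false false neg _ _ = refl
  clamp-id false false zer _ _ = refl
  clamp-id false false pos _ _ = refl

  ⊓-nonpos : ∀ x y → isPos y ≡ false → isPos (x ⊓ y) ≡ false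
  ⊓-nonpos = from-yes (all? λ x → all? λ y →
    (isPos y Bool.≟ false) →-dec (isPos (x ⊓ y) Bool.≟ false))

  ⊔-nonpos : ∀ x y → isPos x ≡ false → isPos y ≡ false → isPos (x ⊔ y) ≡ false
  ⊔-nonpos = from-yes (all? λ x → all? λ y →
    (isPos x Bool.≟ false) →-dec ((isPos y Bool.≟ false) →-dec (isPos (x ⊔ y) Bool.≟ false)))

  ⊔neg-nonpos : ∀ x → isPos (x ⊔ neg) ≡ false
  ⊔neg-nonpos = from-yes (all? λ x → isPos (x ⊔ neg) Bool.≟ false)

  nonpos⊔neg : ∀ x → isPos x ≡ false → x ⊔ neg ≡ neg
  nonpos⊔neg = from-yes (all? λ x → (isPos x Bool.≟ false) →-dec (x ⊔ neg ≟ neg))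

  neg⊔nonpos : ∀ x → isPos x ≡ false → neg ⊔ x ≡ neg
  neg⊔nonpos = from-yes (all? λ x → (isPos x Bool.≟ false) →-dec (neg ⊔ x ≟ neg))

  module Levels {n m : ℕ} (end₁ end₂ : Fin m → Fin n) (loopless : ∀ e → ¬ end₁ e ≡ end₂ e) (b : Fin n → ℤ) where

    open Greedy end₁ end₂ loopless
    open Extension

    Nonpos : (Fin n → Bool) → (Fin n → Sign) → Set
    Nonpos r x = ∀ v → r v ≡ true → isPos (x v) ≡ false

    ρ : (Fin n → Bool) → (Fin n → Sign) → ℤ
    ρ r x = sum λ e → touch (r (end₁ e)) (r (end₂ e)) (x (end₁ e)) (x (end₂ e))

    Invariant : (t : Fin n → ℤ) (r : Fin n → Bool) → Set
    Invariant t r = ∀ x → Nonpos r x → ρ r x ≤ h b t end₁ end₂ x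

    _∖_ : (r I : Fin n → Bool) → Fin n → Bool
    (r ∖ I) v = r v ∧ not (I v)

    module Minimise (t : Fin n → ℤ) (r : Fin n → Bool) where

      H : (Fin n → Sign) → ℤ
      H = h b t end₁ end₂

      Feasible : (Fin n → Bool) → (Fin n → Sign) → Set
      Feasible Z x = Nonpos r x × (∀ v → Z v ≡ true → x v ≡ neg)

      clamped : (Fin n → Bool) → (Fin n → Sign) → Fin n → Sign
      clamped Z x v = clamp (r v) (Z v) (x v)

      best : (Z : Fin n → Bool) → Σ (Vec Sign n) λ xs → ∀ ys → H (clamped Z (lookup xs)) ≤ H (clamped Z (lookup ys))
      best Z = argmin-Vec n λ xs → H (clamped Z (lookup xs))

      abstract

        η-arg : (Fin n → Bool) → Fin n → Sign
        η-arg Z = clamped Z (lookup (proj₁ (best Z)))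

        η-feasible : ∀ Z → Feasible Z (η-arg Z)
        η-feasible Z = (λ v rv → clamp-nonpos (Z v) (lookup (proj₁ (best Z)) v) rv) , neg-on-Z
          where
          neg-on-Z : ∀ v → Z v ≡ true → η-arg Z v ≡ neg
          neg-on-Z v Zv rewrite Zv = refl

      η : (Fin n → Bool) → ℤ
      η Z = H (η-arg Z)

      abstract

        η≤ : ∀ Z x → Feasible Z x → η Z ≤ H x
        η≤ Z x (np , x≡neg) = subst (η Z ≤_) (h-cong b t end₁ end₂ eq) (proj₂ (best Z) (tabulate x))
          where
          eq : ∀ v → clamped Z (lookup (tabulate x)) v ≡ x v
          eq v = trans (cong (clamp (r v) (Z v)) (lookup∘tabulate x v))
                       (clamp-id (r v) (Z v) (x v) (np v) (x≡neg v))

      cost : (Fin n → Bool) → ℤ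
      cost I = sum (λ v → 𝟙 (r v ∧ not (I v)))
             + sum (λ e → ecost (r (end₁ e)) (r (end₂ e)) (I (end₁ e)) (I (end₂ e)))

      Admissible : (Fin n → Bool) → Set
      Admissible I = Independent I × (∀ v → I v ∧ not (r v) ≡ false)

      admissible? : ∀ I → Dec (Admissible I)
      admissible? I = (all? λ e → (I (end₁ e) ∧ I (end₂ e)) Bool.≟ false)
                ×-dec (all? λ v → (I v ∧ not (r v)) Bool.≟ false)

      score : (Fin n → Bool) → ℤ
      score I = cost I - η (r ∖ I)

      bits : Vec (Fin 2) n → Fin n → Bool
      bits xs v = does (lookup xs v ≟ suc zero)

      -- Non-admissible candidates are replaced by ∅, so that the optimum ranges over all bit vectors.
      repair′ : (I : Fin n → Bool) → Dec (Admissible I) → Fin n → Bool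
      repair′ I (yes _) = I
      repair′ I (no _) v = false

      repair : Vec (Fin 2) n → Fin n → Bool
      repair xs = repair′ (bits xs) (admissible? (bits xs))

      repair′-admissible : ∀ I d → Admissible (repair′ I d)
      repair′-admissible I (yes a) = a
      repair′-admissible I (no _) = (λ _ → refl) , λ _ → refl

      repair′-id : ∀ I d → Admissible I → repair′ I d ≡ I
      repair′-id I (yes _) _ = refl
      repair′-id I (no ¬a) a = contradiction a ¬a

      abstract

        -- Competitors are given as `bits xs`, so a competing set given as a function is first
        -- passed through `encode`. This avoids having to show that `score` respects pointwise
        -- equality.
        optimal : Σ (Fin n → Bool) λ I → Admissible I ×
                  (∀ xs → Admissible (bits xs) → score I ≤ score (bits xs))
        optimal with argmin-Vec n (λ xs → score (repair xs))
        ... | xs , min = repair xs , repair′-admissible (bits xs) (admissible? (bits xs)) , λ ys a →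
          subst (λ J → score (repair xs) ≤ score J) (repair′-id (bits ys) (admissible? (bits ys)) a) (min ys)

      abstract

        encode : (Fin n → Bool) → Vec (Fin 2) n
        encode I = tabulate λ v → if I v then suc zero else zero

        bits∘encode : ∀ I v → bits (encode I) v ≡ I v
        bits∘encode I v = trans (cong (λ z → does (z ≟ suc zero)) (lookup∘tabulate _ v)) (lem (I v))
          where
          lem : ∀ i → does ((if i then suc zero else zero) ≟ suc {n = 1} zero) ≡ i
          lem true  = refl
          lem false = refl

  -- Preservation of the invariant when a level is lowered.

  ∧-true : ∀ {p q} → p ∧ q ≡ true → p ≡ true × q ≡ true
  ∧-true {true} {true} _ = refl , refl

  not-true : ∀ {p} → not p ≡ true → p ≡ false
  not-true {false} _ = refl

  ≡true? : ∀ p → p ≡ true ⊎ p ≡ false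
  ≡true? true  = inj₁ refl
  ≡true? false = inj₂ refl

  isNeg-true : ∀ {x} → isNeg x ≡ true → x ≡ neg
  isNeg-true {neg} _ = refl
  isNeg-true {zer} ()
  isNeg-true {pos} ()

  module Step {n m : ℕ} (end₁ end₂ : Fin m → Fin n) (loopless : ∀ e → ¬ end₁ e ≡ end₂ e) (b t : Fin n → ℤ)
    (r : Fin n → Bool) (inv : Levels.Invariant end₁ end₂ loopless b t r) where

    open Greedy end₁ end₂ loopless
    module Ext = Extension
    open Levels end₁ end₂ loopless b
    open Minimise t r

    I : Fin n → Bool
    I = proj₁ optimal

    I-independent : Independent I
    I-independent = proj₁ (proj₁ (proj₂ optimal))

    I⊆r : ∀ v → I v ≡ true → r v ≡ true
    I⊆r v Iv with r v | I v | proj₂ (proj₁ (proj₂ optimal)) v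
    ... | true  | _ | _ = refl
    ... | false | true | ()
    I⊆r v () | false | false | _

    t′ : Fin n → ℤ
    t′ v = t v - 𝟙 ((r ∖ I) v)

    module _ (x : Fin n → Sign) (np : Nonpos (r ∖ I) x) where

      K Y : Fin n → Bool
      K v = I v ∧ not (isPos (x v))
      Y v = (r ∖ I) v ∧ isNeg (x v)

      K-independent : Independent K
      K-independent e with I (end₁ e) | I (end₂ e) | I-independent e
      ... | false | _     | _ = refl
      ... | true  | false | _ = Bool.∧-zeroʳ (not (isPos (x (end₁ e))))

      abstract

        E : Extension K Y (allFin n)
        E = extend K Y K-independent (allFin n)

      -- The competitor of I: give up the vertices where x is positive, then extend maximally into Y.
      I′ : Fin n → Bool
      I′ = bits (encode (Ext.I E))

      I′≡ : ∀ v → I′ v ≡ Ext.I E v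
      I′≡ = bits∘encode (Ext.I E)

      I′-independent : Independent I′
      I′-independent e = trans (cong₂ _∧_ (I′≡ (end₁ e)) (I′≡ (end₂ e))) (Ext.indep E e)

      I′⊆K∪Y : ∀ v → I′ v ≡ true → K v ∨ Y v ≡ true
      I′⊆K∪Y v I′v = Ext.I⊆K∪Y E v (trans (sym (I′≡ v)) I′v)

      K⊆I′ : ∀ v → K v ≡ true → I′ v ≡ true
      K⊆I′ v Kv = trans (I′≡ v) (Ext.K⊆I E v Kv)

      I′⊆r : ∀ v → I′ v ∧ not (r v) ≡ false
      I′⊆r v with r v in rv | I′ v in I′v
      ... | true  | p = Bool.∧-zeroʳ p
      ... | false | false = refl
      ... | false | true with I v in Iv | I′⊆K∪Y v I′v
      ...   | true  | _ = contradiction (trans (sym rv) (I⊆r v Iv)) λ ()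
      ...   | false | K∪Y rewrite rv = contradiction K∪Y λ ()

      A : Fin n → Bool
      A = r ∖ K

      ν ξ β : Fin n → Sign
      ν = η-arg A
      ξ = η-arg Y
      β = η-arg (r ∖ I′)

      views : ∀ v → View (r v) (I v) (I′ v) (x v) (ν v)
      views v = view (r v) (I v) (I′ v) (x v) (ν v) (I⊆r v)
        (λ I′v → trans (cong ((I v ∧ not (isPos (x v))) ∨_) (sym (Bool.∧-assoc (r v) (not (I v)) _))) (I′⊆K∪Y v I′v))
        (K⊆I′ v) (np v) (proj₂ (η-feasible A) v)

      A-or-K : ∀ v → r v ≡ true → A v ≡ true ⊎ K v ≡ true
      A-or-K v rv with K v
      ... | true  = inj₂ refl
      ... | false = inj₁ (trans (Bool.∧-identityʳ (r v)) rv)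

      r∖I⊆A : ∀ v → (r ∖ I) v ≡ true → A v ≡ true
      r∖I⊆A v p with r v | I v
      ... | true | false = refl

      Y⊆r∖I : ∀ v → Y v ≡ true → (r ∖ I) v ≡ true
      Y⊆r∖I v Yv = proj₁ (∧-true Yv)

      ν≡neg : ∀ v → A v ≡ true → ν v ≡ neg
      ν≡neg = proj₂ (η-feasible A)

      x⊓ν-feasible : Feasible Y (λ v → x v ⊓ ν v)
      x⊓ν-feasible = (λ v rv → ⊓-nonpos (x v) (ν v) (proj₁ (η-feasible A) v rv))
                   , λ v Yv → cong₂ _⊓_ (isNeg-true (proj₂ (∧-true {(r ∖ I) v} Yv))) (ν≡neg v (r∖I⊆A v (Y⊆r∖I v Yv)))

      -- Positive values of `x` inside `r` occur only at vertices of `I` outside `K`. These lie in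
      -- `A`, where `ν` is negative and cancels them.
      x⊔ν-feasible : Feasible (r ∖ I) (λ v → x v ⊔ ν v)
      x⊔ν-feasible = nonpos , λ v p → trans (cong (x v ⊔_) (ν≡neg v (r∖I⊆A v p))) (nonpos⊔neg (x v) (np v p))
        where
        nonpos : Nonpos r (λ v → x v ⊔ ν v)
        nonpos v rv with A-or-K v rv
        ... | inj₁ Av = trans (cong (λ z → isPos (x v ⊔ z)) (ν≡neg v Av)) (⊔neg-nonpos (x v))
        ... | inj₂ Kv = ⊔-nonpos (x v) (ν v) (not-true (proj₂ (∧-true {I v} Kv))) (proj₁ (η-feasible A) v rv)

      -- Since `I′ ⊆ K ∪ Y`, the set `A` is covered by `r ∖ I′`, where `β` is negative, and `Y`,
      -- where `ξ` is.
      β⊔ξ-feasible : Feasible A (λ v → β v ⊔ ξ v)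
      β⊔ξ-feasible = (λ v rv → ⊔-nonpos (β v) (ξ v) (proj₁ (η-feasible (r ∖ I′)) v rv) (proj₁ (η-feasible Y) v rv)) , negative
        where
        negative : ∀ v → A v ≡ true → β v ⊔ ξ v ≡ neg
        negative v Av with ≡true? (I′ v)
        ... | inj₂ I′v = trans (cong (_⊔ ξ v) (proj₂ (η-feasible (r ∖ I′)) v
                           (cong₂ _∧_ (proj₁ (∧-true Av)) (cong not I′v))))
                         (neg⊔nonpos (ξ v) (proj₁ (η-feasible Y) v (proj₁ (∧-true Av))))
        ... | inj₁ I′v = trans (cong (β v ⊔_) (proj₂ (η-feasible Y) v
                           (trans (cong (_∨ Y v) (sym (not-true (proj₂ (∧-true {r v} Av))))) (I′⊆K∪Y v I′v))))
                         (nonpos⊔neg (β v) (proj₁ (η-feasible (r ∖ I′)) v (proj₁ (∧-true Av))))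

      β⊓ξ-nonpos : Nonpos r (λ v → β v ⊓ ξ v)
      β⊓ξ-nonpos v rv = ⊓-nonpos (β v) (ξ v) (proj₁ (η-feasible Y) v rv)

      Q : Fin n → Bool
      Q v = residual (r v) (I v) (I′ v) (x v)

      Q⇒ : ∀ v → Q v ≡ true → Y v ≡ true × I′ v ≡ false
      Q⇒ v Qv =
        let rv , p = ∧-true {r v} Qv
            Iv , p′ = ∧-true {not (I v)} p
            xv , I′v = ∧-true {isNeg (x v)} p′
        in cong₂ _∧_ (cong₂ _∧_ rv Iv) xv , not-true I′v

      Q-neg : ∀ v → Q v ≡ true → β v ⊓ ξ v ≡ neg
      Q-neg v Qv = let Yv , I′v = Q⇒ v Qv in
        cong₂ _⊓_ (proj₂ (η-feasible (r ∖ I′)) v (cong₂ _∧_ (proj₁ (∧-true {r v} Qv)) (cong not I′v)))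
                  (proj₂ (η-feasible Y) v Yv)

      touchQ links deficit : Fin m → ℤ
      touchQ e = 𝟙 (r (end₁ e) ∧ r (end₂ e) ∧ (Q (end₁ e) ∨ Q (end₂ e)))
      links e = 𝟙 (Q (end₁ e) ∧ I′ (end₂ e)) + 𝟙 (Q (end₂ e) ∧ I′ (end₁ e))
      deficit e = defect (x (end₁ e)) (x (end₂ e)) (ν (end₁ e)) (ν (end₂ e))

      -- Both `β` and `ξ` are negative on `Q`. Hence the old invariant, applied to their meet, pays
      -- for the edges inside `r` that meet residual vertices.
      touchQ≤ρ : sum touchQ ≤ ρ r (λ v → β v ⊓ ξ v)
      touchQ≤ρ = sum-mono λ e → mono (r (end₁ e)) (r (end₂ e)) (Q-neg (end₁ e)) (Q-neg (end₂ e))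
        where
        mono : ∀ p p′ {q q′ z z′} → (q ≡ true → z ≡ neg) → (q′ ≡ true → z′ ≡ neg) →
               𝟙 (p ∧ p′ ∧ (q ∨ q′)) ≤ touch p p′ z z′
        mono false p′ _ _ = ℤ.≤-refl
        mono true false _ _ = ℤ.≤-refl
        mono true true {true} f _ with refl ← f refl = ℤ.≤-refl
        mono true true {false} {true} {z} _ f with refl ← f refl =
          ℤ.≤-reflexive (cong 𝟙 (sym (Bool.∨-zeroʳ (isNeg z))))
        mono true true {false} {false} {z} {z′} _ _ = 0≤𝟙 (isNeg z ∨ isNeg z′)

      -- A residual vertex lies in `Y` but not in `I′`, so by maximality it has a neighbour in `I′`.
      -- Double counting the incidences turns this into a bound over edges.
      Q≤links : sum (λ v → 𝟙 (Q v)) ≤ sum links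
      Q≤links = ℤ.≤-trans (sum-mono (λ v → bound v (≡true? (Q v))))
                  (ℤ.≤-reflexive (trans (∑-comm (λ v e → incid v e)) (sum-cong-≗ collapse)))
        where
        incid : Fin n → Fin m → ℤ
        incid v e = δ (end₁ e) v * 𝟙 (Q v ∧ I′ (end₂ e)) + δ (end₂ e) v * 𝟙 (Q v ∧ I′ (end₁ e))
        collapse : ∀ e → sum (λ v → incid v e) ≡ links e
        collapse e = trans (∑-distrib-+ (λ v → δ (end₁ e) v * 𝟙 (Q v ∧ I′ (end₂ e))) (λ v → δ (end₂ e) v * 𝟙 (Q v ∧ I′ (end₁ e))))
          (cong₂ _+_ (sum-δ (end₁ e) (λ v → 𝟙 (Q v ∧ I′ (end₂ e)))) (sum-δ (end₂ e) (λ v → 𝟙 (Q v ∧ I′ (end₁ e)))))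
        0≤δ𝟙 : ∀ i j p → 0ℤ ≤ δ i j * 𝟙 p
        0≤δ𝟙 i j false = ℤ.≤-reflexive (sym (ℤ.*-zeroʳ (δ i j)))
        0≤δ𝟙 i j true  = subst (0ℤ ≤_) (sym (ℤ.*-identityʳ (δ i j))) (0≤δ i j)
        0≤incid : ∀ v e → 0ℤ ≤ incid v e
        0≤incid v e = 0≤+ (0≤δ𝟙 (end₁ e) v (Q v ∧ I′ (end₂ e))) (0≤δ𝟙 (end₂ e) v (Q v ∧ I′ (end₁ e)))
        one : ∀ {u v p} → u ≡ v → p ≡ true → δ u v * 𝟙 p ≡ 1ℤ
        one {u} refl refl = trans (ℤ.*-identityʳ (δ u u)) (δ-refl u)
        met : ∀ v → Q v ≡ true → Σ (Fin m) (Meets v (Ext.I E)) → 1ℤ ≤ sum (incid v)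
        met v Qv (e , inj₁ (p , Ie)) = ℤ.≤-trans (subst (_≤ incid v e) (one p (cong₂ _∧_ Qv (trans (I′≡ _) Ie)))
          (subst (_≤ incid v e) (ℤ.+-identityʳ _) (ℤ.+-monoʳ-≤ (δ (end₁ e) v * 𝟙 (Q v ∧ I′ (end₂ e))) (0≤δ𝟙 (end₂ e) v (Q v ∧ I′ (end₁ e))))))
          (term≤sum (0≤incid v) e)
        met v Qv (e , inj₂ (p , Ie)) = ℤ.≤-trans (subst (_≤ incid v e) (one p (cong₂ _∧_ Qv (trans (I′≡ _) Ie)))
          (subst (_≤ incid v e) (ℤ.+-identityˡ _) (ℤ.+-monoˡ-≤ (δ (end₂ e) v * 𝟙 (Q v ∧ I′ (end₁ e))) (0≤δ𝟙 (end₁ e) v (Q v ∧ I′ (end₂ e))))))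
          (term≤sum (0≤incid v) e)
        bound : ∀ v → Q v ≡ true ⊎ Q v ≡ false → 𝟙 (Q v) ≤ sum (incid v)
        bound v (inj₂ Qv) = subst (λ z → 𝟙 z ≤ sum (incid v)) (sym Qv) (sum-nonneg (0≤incid v))
        bound v (inj₁ Qv) = subst (λ z → 𝟙 z ≤ sum (incid v)) (sym Qv) (met v Qv (meeting (Ext.maximal E v (∈-allFin v) (proj₁ (Q⇒ v Qv)))))
          where
          meeting : Ext.I E v ≡ true ⊎ Σ (Fin m) (Meets v (Ext.I E)) → Σ (Fin m) (Meets v (Ext.I E))
          meeting (inj₁ Iv) = contradiction (trans (sym (proj₂ (Q⇒ v Qv))) (trans (I′≡ v) Iv)) λ ()
          meeting (inj₂ meets) = meets

      cv cv′ ys os qs : ℤ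
      cv  = sum λ v → 𝟙 (r v ∧ not (I v))
      cv′ = sum λ v → 𝟙 (r v ∧ not (I′ v))
      ys  = sum λ v → 𝟙 (Y v)
      os  = sum λ v → 𝟙 (opp (x v) (ν v))
      qs  = sum λ v → 𝟙 (Q v)
      ce ce′ : ℤ
      ce  = sum λ e → ecost (r (end₁ e)) (r (end₂ e)) (I (end₁ e)) (I (end₂ e))
      ce′ = sum λ e → ecost (r (end₁ e)) (r (end₂ e)) (I′ (end₁ e)) (I′ (end₂ e))

      vertex-count : cv′ + ys ≤ os + (qs + cv)
      vertex-count = subst₂ _≤_ (∑-distrib-+ (λ v → 𝟙 (r v ∧ not (I′ v))) (λ v → 𝟙 (Y v)))
        (trans (∑-distrib-+ (λ v → 𝟙 (opp (x v) (ν v))) (λ v → 𝟙 (Q v) + 𝟙 (r v ∧ not (I v))))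
               (cong (_+_ os) (∑-distrib-+ (λ v → 𝟙 (Q v)) (λ v → 𝟙 (r v ∧ not (I v))))))
        (sum-mono λ v → subst (λ z → 𝟙 (r v ∧ not (I′ v)) + 𝟙 z ≤ 𝟙 (opp (x v) (ν v)) + (𝟙 (Q v) + 𝟙 (r v ∧ not (I v))))
                           (sym (Bool.∧-assoc (r v) (not (I v)) (isNeg (x v)))) (vertex-check (views v)))

      edge-count : (ce′ + ρ (r ∖ I) x) + sum links ≤ sum deficit + (sum touchQ + ce)
      edge-count = subst₂ _≤_
        (trans (∑-distrib-+ (λ e → ec′ e + to e) links) (cong (_+ sum links) (∑-distrib-+ ec′ to)))
        (trans (∑-distrib-+ deficit (λ e → touchQ e + ec e)) (cong (_+_ (sum deficit)) (∑-distrib-+ touchQ ec)))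
        (sum-mono λ e → edge-check (views (end₁ e)) (views (end₂ e)) (I-independent e) (I′-independent e)
                          (0≤defect (x (end₁ e)) (x (end₂ e)) (ν (end₁ e)) (ν (end₂ e))) refl)
        where
        ec ec′ to : Fin m → ℤ
        ec  e = ecost (r (end₁ e)) (r (end₂ e)) (I (end₁ e)) (I (end₂ e))
        ec′ e = ecost (r (end₁ e)) (r (end₂ e)) (I′ (end₁ e)) (I′ (end₂ e))
        to  e = touch ((r ∖ I) (end₁ e)) ((r ∖ I) (end₂ e)) (x (end₁ e)) (x (end₂ e))

      I′-admissible : Admissible I′
      I′-admissible = I′-independent , I′⊆r

      -- Uncrossing `x` with `ν` bounds `H x + η A` below by `η Y + η (r ∖ I)` plus the surplus.
      -- Uncrossing `β` with `ξ` bounds `η (r ∖ I′) + η Y` below by `η A + sum touchQ`. Adding these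
      -- cancels `η A` and `η Y`; optimality of `I` against `I′` replaces the remaining difference
      -- of `η` values by a difference of costs, which `vertex-count`, `edge-count` and `Q≤links`
      -- evaluate.
      step-bound : ys + ρ (r ∖ I) x ≤ H x
      step-bound = ℤ.0≤i-j⇒j≤i (subst (0ℤ ≤_) total
          (0≤+ (0≤+ (0≤+ (0≤+ (0≤+ (0≤+ (0≤+ (0≤+ (0≤+
            (ℤ.i≤j⇒0≤j-i edge-count) (ℤ.i≤j⇒0≤j-i vertex-count)) (ℤ.i≤j⇒0≤j-i Q≤links))
            (ℤ.i≤j⇒0≤j-i (η≤ Y _ x⊓ν-feasible))) (ℤ.i≤j⇒0≤j-i (η≤ (r ∖ I) _ x⊔ν-feasible)))
            (ℤ.i≤j⇒0≤j-i (proj₂ (proj₂ optimal) (encode (Ext.I E)) I′-admissible)))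
            (ℤ.i≤j⇒0≤j-i touchQ≤ρ)) (ℤ.i≤j⇒0≤j-i (inv (λ v → β v ⊓ ξ v) β⊓ξ-nonpos)))
            (ℤ.i≤j⇒0≤j-i (η≤ A _ β⊔ξ-feasible))) (0≤surplus b t end₁ end₂ β ξ)))
        where
        Hx⊓ν Hx⊔ν Hβ⊓ξ Hβ⊔ξ ρβξ σ₂ : ℤ
        Hx⊓ν = H (λ v → x v ⊓ ν v)
        Hx⊔ν = H (λ v → x v ⊔ ν v)
        Hβ⊓ξ = H (λ v → β v ⊓ ξ v)
        Hβ⊔ξ = H (λ v → β v ⊔ ξ v)
        ρβξ = ρ r (λ v → β v ⊓ ξ v)
        σ₂ = surplus b t end₁ end₂ β ξ
        linear : ∀ D TQ ce ce′ ρ′ G os qs cv cv′ ys x⊓ν x⊔ν hY hRI hRI′ hA hx β⊓ξ β⊔ξ ρβξ s →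
          ((((((((((D + (TQ + ce)) - ((ce′ + ρ′) + G)) + ((os + (qs + cv)) - (cv′ + ys))) + (G - qs))
            + (x⊓ν - hY)) + (x⊔ν - hRI)) + (((cv′ + ce′) - hRI′) - ((cv + ce) - hRI)))
            + (ρβξ - TQ)) + (β⊓ξ - ρβξ)) + (β⊔ξ - hA)) + s
          ≡ (hx - (ys + ρ′)) + (((x⊓ν + x⊔ν) + (os + D)) - (hx + hA)) + (((β⊓ξ + β⊔ξ) + s) - (hRI′ + hY))
        linear = solve-∀
        cancel : ∀ p q r′ → p + (q - q) + (r′ - r′) ≡ p
        cancel = solve-∀
        total = trans (linear (sum deficit) (sum touchQ) ce ce′ (ρ (r ∖ I) x) (sum links) os qs cv cv′ ys
                         Hx⊓ν Hx⊔ν (η Y) (η (r ∖ I)) (η (r ∖ I′)) (η A) (H x) Hβ⊓ξ Hβ⊔ξ ρβξ σ₂)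
               (trans (cong₂ (λ p q → (H x - (ys + ρ (r ∖ I) x)) + (p - (H x + η A)) + (q - (η (r ∖ I′) + η Y)))
                         (sym (uncross b t end₁ end₂ x ν)) (sym (uncross b t end₁ end₂ β ξ)))
                      (cancel (H x - (ys + ρ (r ∖ I) x)) (H x + η A) (η (r ∖ I′) + η Y)))

      -- Lowering `t` by 1 on `r ∖ I` adds `val (x v)` to each term there. As `x` is nonpositive on
      -- that set, only the vertices of `Y` contribute, each with -1.
      h-t′ : h b t′ end₁ end₂ x ≡ H x - ys
      h-t′ = trans (cong (_+ ex) (trans (sum-cong-≗ pt) (trans (∑-distrib-+ vx (λ v → - 𝟙 (Y v))) (cong (_+_ (sum vx)) (sum-neg (λ v → 𝟙 (Y v)))))))
                   (swap (sum vx) ex ys)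
        where
        vx : Fin n → ℤ
        vx v = vterm b t (x v) v
        ex = sum (λ e → ε (x (end₁ e)) (x (end₂ e)))
        swap : ∀ p q s → (p + - s) + q ≡ (p + q) - s
        swap = solve-∀
        sum-neg : ∀ {k} (f : Fin k → ℤ) → sum (λ i → - f i) ≡ - sum f
        sum-neg {zero} f = refl
        sum-neg {suc k} f = trans (cong (_+_ (- f zero)) (sum-neg (λ i → f (suc i)))) (sym (ℤ.neg-distrib-+ (f zero) _))
        pt : ∀ v → vterm b t′ (x v) v ≡ vx v + - 𝟙 (Y v)
        pt v = lem (x v) ((r ∖ I) v) (np v)
          where
          lemneg : ∀ p q → -1ℤ * (p - (q - 1ℤ)) + 0ℤ ≡ (-1ℤ * (p - q) + 0ℤ) + - 1ℤ
          lemneg = solve-∀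
          lemzer : ∀ p q s → 0ℤ * (p - (q - s)) + 0ℤ ≡ (0ℤ * (p - q) + 0ℤ) + - 0ℤ
          lemzer = solve-∀
          lemoff : ∀ p q s i → p * (q - (s - 0ℤ)) + i ≡ (p * (q - s) + i) + - 0ℤ
          lemoff = solve-∀
          lem : ∀ z p → (p ≡ true → isPos z ≡ false) →
                val z * (b v - (t v - 𝟙 p)) + 𝟙 (isPos z) ≡ (val z * (b v - t v) + 𝟙 (isPos z)) + - 𝟙 (p ∧ isNeg z)
          lem neg true _ = lemneg (b v) (t v)
          lem zer true _ = lemzer (b v) (t v) 1ℤ
          lem pos true f = contradiction (f refl) λ ()
          lem z false _ = lemoff (val z) (b v) (t v) (𝟙 (isPos z))

    step-invariant : Invariant t′ (r ∖ I)
    step-invariant x np = subst (ρ (r ∖ I) x ≤_) (sym (h-t′ x np))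
      (ℤ.0≤i-j⇒j≤i (subst (0ℤ ≤_) (lem (H x) (ys x np) (ρ (r ∖ I) x)) (ℤ.i≤j⇒0≤j-i (step-bound x np))))
      where
      lem : ∀ p q s → p - (q + s) ≡ (p - q) - s
      lem = solve-∀

  -- Descent through the levels.

  i-1<i : ∀ i → i - 1ℤ < i
  i-1<i i = ℤ.≤-<-trans (ℤ.≤-reflexive (ℤ.+-comm i -1ℤ)) (ℤ.i≤pred[j]⇒i<j ℤ.≤-refl)

  module Loop {n m : ℕ} (end₁ end₂ : Fin m → Fin n) (loopless : ∀ e → ¬ end₁ e ≡ end₂ e) (b : Fin n → ℤ) where

    open Greedy end₁ end₂ loopless using (Independent)
    open Levels end₁ end₂ loopless b

    Attainable Proper-colouring : (Fin n → ℤ) → Set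
    Attainable t = ∀ x → 0ℤ ≤ h b t end₁ end₂ x
    Proper-colouring t = ∀ e → ¬ t (end₁ e) ≡ t (end₂ e)

    record State (s : ℤ) (t : Fin n → ℤ) (r : Fin n → Bool) : Set where
      field
        invariant : Invariant t r
        unplaced  : ∀ v → r v ≡ true → t v ≡ s
        placed>   : ∀ v → r v ≡ false → s < t v
        proper    : ∀ e → r (end₁ e) ≡ false → r (end₂ e) ≡ false → ¬ t (end₁ e) ≡ t (end₂ e)

    open State

    0≤ρ : ∀ r x → 0ℤ ≤ ρ r x
    0≤ρ r x = sum-nonneg λ e →
      0≤𝟙 (r (end₁ e) ∧ r (end₂ e) ∧ (isNeg (x (end₁ e)) ∨ isNeg (x (end₂ e))))

    unit-nonpos : ∀ {k} (i j : Fin k) → isPos (unit neg i j) ≡ false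
    unit-nonpos zero    zero    = refl
    unit-nonpos zero    (suc j) = refl
    unit-nonpos (suc i) zero    = refl
    unit-nonpos (suc i) (suc j) = unit-nonpos i j

    ε-nonpos : ∀ x y → isPos x ≡ false → isPos y ≡ false → ε x y ≡ 0ℤ
    ε-nonpos = from-yes (all? λ x → all? λ y →
      (isPos x Bool.≟ false) →-dec ((isPos y Bool.≟ false) →-dec (ε x y ℤ.≟ 0ℤ)))

    h-nonpos : ∀ t x → (∀ v → isPos (x v) ≡ false) → h b t end₁ end₂ x ≡ sum (λ v → vterm b t (x v) v)
    h-nonpos t x np = trans (cong (_+_ (sum (λ v → vterm b t (x v) v)))
      (sum-zero λ e → ε-nonpos (x (end₁ e)) (x (end₂ e)) (np (end₁ e)) (np (end₂ e)))) (ℤ.+-identityʳ _)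

    -- The invariant, tested on the vector that is negative at `v` alone, yields `0 ≤ t v - b v`.
    b≤s : ∀ {s t r} → State s t r → ∀ v → r v ≡ true → b v ≤ s
    b≤s {s} {t} {r} st v rv = subst (b v ≤_) (unplaced st v rv) (ℤ.0≤i-j⇒j≤i (subst (0ℤ ≤_) eq
        (ℤ.≤-trans (0≤ρ r (unit neg v)) (invariant st (unit neg v) (λ w _ → unit-nonpos v w)))))
      where
      lem : ∀ p q → -1ℤ * (p - q) + 0ℤ ≡ q - p
      lem = solve-∀
      eq : h b t end₁ end₂ (unit neg v) ≡ t v - b v
      eq = trans (h-nonpos t (unit neg v) (unit-nonpos v)) (trans (sum-unit b t neg v) (lem (b v) (t v)))

    -- Properness survives because the vertices placed now form an independent set at level `s`,
    -- while all earlier ones lie strictly above `s`.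
    lower : ∀ {s t r} → State s t r → Σ (Fin n → ℤ) λ t′ → Σ (Fin n → Bool) λ r′ → State (s - 1ℤ) t′ r′
    lower {s} {t} {r} st = t′ , r ∖ I , record
      { invariant = step-invariant ; unplaced = unplaced′ ; placed> = placed>′ ; proper = proper′ }
      where
      open Step end₁ end₂ loopless b t r (invariant st)
      data Fate (v : Fin n) : Set where
        later  : (r ∖ I) v ≡ true → t′ v ≡ s - 1ℤ → Fate v
        now    : I v ≡ true → (r ∖ I) v ≡ false → t′ v ≡ s → Fate v
        before : r v ≡ false → (r ∖ I) v ≡ false → t′ v ≡ t v → s < t v → Fate v
      minus0 : ∀ i → i - 0ℤ ≡ i
      minus0 = ℤ.+-identityʳ
      fate : ∀ v → Fate v
      fate v with r v in rv | I v in Iv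
      ... | true | true = now Iv (cong₂ (λ p q → p ∧ not q) rv Iv)
              (trans (cong (λ p → t v - 𝟙 p) (cong₂ (λ p q → p ∧ not q) rv Iv)) (trans (minus0 (t v)) (unplaced st v rv)))
      ... | true | false = later (cong₂ (λ p q → p ∧ not q) rv Iv)
              (trans (cong (λ p → t v - 𝟙 p) (cong₂ (λ p q → p ∧ not q) rv Iv)) (cong (_- 1ℤ) (unplaced st v rv)))
      ... | false | _ = before rv (cong (_∧ not (I v)) rv)
              (trans (cong (λ p → t v - 𝟙 p) (cong (_∧ not (I v)) rv)) (minus0 (t v))) (placed> st v rv)
      unplaced′ : ∀ v → (r ∖ I) v ≡ true → t′ v ≡ s - 1ℤ
      unplaced′ v p with fate v
      ... | later _ eq = eq
      ... | now _ p′ _ = contradiction (trans (sym p) p′) λ ()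
      ... | before _ p′ _ _ = contradiction (trans (sym p) p′) λ ()
      placed>′ : ∀ v → (r ∖ I) v ≡ false → s - 1ℤ < t′ v
      placed>′ v p with fate v
      ... | later p′ _ = contradiction (trans (sym p) p′) λ ()
      ... | now _ _ eq = subst (s - 1ℤ <_) (sym eq) (i-1<i s)
      ... | before _ _ eq s<t = subst (s - 1ℤ <_) (sym eq) (ℤ.<-trans (i-1<i s) s<t)
      proper′ : ∀ e → (r ∖ I) (end₁ e) ≡ false → (r ∖ I) (end₂ e) ≡ false → ¬ t′ (end₁ e) ≡ t′ (end₂ e)
      proper′ e p₁ p₂ eq with fate (end₁ e) | fate (end₂ e)
      ... | later p _ | _ = contradiction (trans (sym p₁) p) λ ()
      ... | now _ _ _ | later p _ = contradiction (trans (sym p₂) p) λ ()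
      ... | before _ _ _ _ | later p _ = contradiction (trans (sym p₂) p) λ ()
      ... | now I₁ _ _ | now I₂ _ _ = contradiction (trans (sym (I-independent e)) (cong₂ _∧_ I₁ I₂)) λ ()
      ... | now _ _ e₁ | before _ _ e₂ s<t = ℤ.<-irrefl (trans (sym e₁) (trans eq e₂)) s<t
      ... | before _ _ e₁ s<t | now _ _ e₂ = ℤ.<-irrefl (trans (sym e₂) (trans (sym eq) e₁)) s<t
      ... | before r₁ _ e₁ _ | before r₂ _ e₂ _ = proper st e r₁ r₂ (trans (sym e₁) (trans eq e₂))

    -- Here `k` bounds the number of levels left. At 0 the level is below every `b v`, so `b≤s`
    -- leaves nothing unplaced; the sign constraint of the invariant becomes vacuous and the
    -- invariant gives attainability.
    descend : ∀ k {s t r} → State s t r → (∀ v → s < b v + + k) →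
              Σ (Fin n → ℤ) λ t′ → Attainable t′ × Proper-colouring t′
    descend zero {s} {t} {r} st s<b = t , attainable , λ e → proper st e (all-placed (end₁ e)) (all-placed (end₂ e))
      where
      all-placed : ∀ v → r v ≡ false
      all-placed v with r v in rv
      ... | false = refl
      ... | true = contradiction (subst (s <_) (ℤ.+-identityʳ (b v)) (s<b v)) (ℤ.≤⇒≯ (b≤s st v rv))
      attainable : Attainable t
      attainable x = ℤ.≤-trans (0≤ρ r x) (invariant st x λ v rv → contradiction (trans (sym (all-placed v)) rv) λ ())
    descend (suc k) {s} st s<b = let _ , _ , st′ = lower st in descend k st′ λ v →
      subst (s - 1ℤ <_) (lem (b v) (+ k)) (ℤ.+-monoˡ-< -1ℤ (s<b v))
      where
      lem : ∀ p q → (p + (1ℤ + q)) + -1ℤ ≡ p + q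
      lem = solve-∀

    B s₀ : ℤ
    B  = sum λ v → + ∣ b v ∣
    s₀ = + m + B

    ∣b∣≤B : ∀ v → + ∣ b v ∣ ≤ B
    ∣b∣≤B = term≤sum {f = λ v → + ∣ b v ∣} λ v → +≤+ z≤n

    sum-ones : ∀ k → sum {k} (λ _ → 1ℤ) ≡ + k
    sum-ones zero    = refl
    sum-ones (suc k) = cong (_+_ 1ℤ) (sum-ones k)

    -- The starting level satisfies `s₀ - b v ≥ m`, so a single negative vertex already pays for all
    -- `m` edges.
    initial : State s₀ (λ _ → s₀) (λ _ → true)
    initial = record
      { invariant = λ x np → subst (ρ (λ _ → true) x ≤_) (sym (h-nonpos (λ _ → s₀) x (λ v → np v refl))) (bound x (λ v → np v refl))
      ; unplaced = λ _ _ → refl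
      ; placed> = λ _ ()
      ; proper = λ _ () }
      where
      i≤∣i∣ : ∀ i → i ≤ + ∣ i ∣
      i≤∣i∣ (+ k) = ℤ.≤-refl
      i≤∣i∣ -[1+ k ] = -≤+
      lemneg : ∀ p q k → -1ℤ * (p - (k + q)) + 0ℤ ≡ k + (q - p)
      lemneg = solve-∀
      bound : ∀ x → (∀ v → isPos (x v) ≡ false) → ρ (λ _ → true) x ≤ sum (λ v → vterm b (λ _ → s₀) (x v) v)
      bound x np = ℤ.≤-trans (sum-mono touch≤) (subst (_≤ sum (λ v → vterm b (λ _ → s₀) (x v) v))
                     (∑-comm {n} {m} (λ v _ → 𝟙 (isNeg (x v)))) (sum-mono λ v → column (x v) v (np v)))
        where
        0≤neg : ∀ v → 0ℤ ≤ 𝟙 (isNeg (x v))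
        0≤neg v = 0≤𝟙 (isNeg (x v))
        touch≤ : ∀ e → 𝟙 (isNeg (x (end₁ e)) ∨ isNeg (x (end₂ e))) ≤ sum (λ v → 𝟙 (isNeg (x v)))
        touch≤ e = ∨-bound (isNeg (x (end₁ e))) _ (term≤sum 0≤neg (end₁ e)) (term≤sum 0≤neg (end₂ e))
        column : ∀ z v → isPos z ≡ false → sum {m} (λ _ → 𝟙 (isNeg z)) ≤ vterm b (λ _ → s₀) z v
        column neg v _ = subst₂ _≤_ (sym (sum-ones m)) (sym (lemneg (b v) B (+ m)))
          (subst (_≤ + m + (B - b v)) (ℤ.+-identityʳ (+ m)) (ℤ.+-monoʳ-≤ (+ m)
            (ℤ.i≤j⇒0≤j-i (ℤ.≤-trans (i≤∣i∣ (b v)) (∣b∣≤B v)))))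
        column pos v ()
        column zer v _ = ℤ.≤-reflexive (trans (sum-replicate-zero m) (sym (vterm-zer b (λ _ → s₀) v)))

    colouring : Σ (Fin n → ℤ) λ t → Attainable t × Proper-colouring t
    -- Since `b v ≥ - B`, adding `1 + s₀ + B` to any base exceeds `s₀`.
    colouring = descend (suc ∣ s₀ + B ∣) initial λ v → ℤ.<-≤-trans (below v) (ℤ.≤-reflexive (cong (λ z → b v + (1ℤ + z)) (sym abs)))
      where
      0≤B : 0ℤ ≤ B
      0≤B = sum-nonneg {f = λ v → + ∣ b v ∣} λ v → +≤+ z≤n
      abs : + ∣ s₀ + B ∣ ≡ s₀ + B
      abs = ℤ.0≤i⇒+∣i∣≡i (0≤+ (0≤+ (+≤+ z≤n) 0≤B) 0≤B)
      -∣i∣≤i : ∀ i → 0ℤ ≤ + ∣ i ∣ + i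
      -∣i∣≤i (+ k) = +≤+ z≤n
      -∣i∣≤i -[1+ k ] = ℤ.≤-reflexive (sym (ℤ.+-inverseʳ (+ suc k)))
      lem : ∀ s p q → s + (p + q) ≡ q + (s + p)
      lem = solve-∀
      lem₁ : ∀ p s → 1ℤ + (p + s) ≡ p + (1ℤ + s)
      lem₁ = solve-∀
      below : ∀ v → s₀ < b v + (1ℤ + (s₀ + B))
      below v = ℤ.suc[i]≤j⇒i<j (subst (1ℤ + s₀ ≤_) (lem₁ (b v) (s₀ + B)) (ℤ.+-monoʳ-≤ 1ℤ
        (subst₂ _≤_ (ℤ.+-identityʳ s₀) (lem s₀ B (b v)) (ℤ.+-monoʳ-≤ s₀
          (ℤ.≤-trans (-∣i∣≤i (b v)) (ℤ.+-monoˡ-≤ (b v) (∣b∣≤B v)))))))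

  abstract

    integer-weighting : ∀ {n m} (end₁ end₂ : Fin m → Fin n) (loopless : ∀ e → ¬ end₁ e ≡ end₂ e) (b : Fin n → ℤ) →
      Σ (Fin m → Bool) λ y → Σ (Fin n → Bool) λ w →
      let t = λ v → b v + 𝟙 (w v) + sum (λ e → 𝟙 (y e) * (δ (end₁ e) v + δ (end₂ e) v))
      in ∀ e → ¬ t (end₁ e) ≡ t (end₂ e)
    integer-weighting {n} {m} end₁ end₂ loopless b =
      let t , attainable , proper = Loop.colouring end₁ end₂ loopless b
          y , w , t≡ = integral-point m end₁ end₂ b t attainable
      in y , w , λ e eq → proper e (trans (t≡ (end₁ e)) (trans eq (sym (t≡ (end₂ e)))))

open IntegerWeighting using (𝟙; δ; δ-refl; integer-weighting)

-- Transfer from integers to reals.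

bitℕ : Bool → ℕ
bitℕ false = 0
bitℕ true  = 1

+bitℕ : ∀ x → + bitℕ x ≡ 𝟙 x
+bitℕ false = ≡.refl
+bitℕ true  = ≡.refl

bitℕ≤1 : ∀ x → bitℕ x ℕ.≤ 1
bitℕ≤1 false = z≤n
bitℕ≤1 true  = s≤s z≤n

sumℕ : ∀ {n} → (Fin n → ℕ) → ℕ
sumℕ {zero}  f = 0
sumℕ {suc n} f = f zero ℕ.+ sumℕ (λ i → f (suc i))

+sumℕ : ∀ {n} (f : Fin n → ℕ) → + sumℕ f ≡ sum (λ i → + f i)
+sumℕ {zero}  f = ≡.refl
+sumℕ {suc n} f = ≡.cong (ℤ._+_ (+ f zero)) (+sumℕ (λ i → f (suc i)))

sumℕ≤ : ∀ {n} (f : Fin n → ℕ) → (∀ i → f i ℕ.≤ 1) → sumℕ f ℕ.≤ n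
sumℕ≤ {zero}  f f≤1 = z≤n
sumℕ≤ {suc n} f f≤1 = ℕ.+-mono-≤ (f≤1 zero) (sumℕ≤ (λ i → f (suc i)) (λ i → f≤1 (suc i)))

δ-≢ : ∀ {n} {i j : Fin n} → ¬ i ≡ j → δ i j ≡ 0ℤ
δ-≢ {i = zero}  {zero}  i≢j = contradiction ≡.refl i≢j
δ-≢ {i = zero}  {suc j} i≢j = ≡.refl
δ-≢ {i = suc i} {zero}  i≢j = ≡.refl
δ-≢ {i = suc i} {suc j} i≢j = δ-≢ {i = i} {j} (λ i≡j → i≢j (≡.cong suc i≡j))

module Reals (ℝ : RealNumbers) (a : RealNumbers.Carrier ℝ) (0<a : RealNumbers._<_ ℝ (RealNumbers.0# ℝ) a) where

  open RealNumbers ℝ hiding (zero)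
  open Mult +-monoid using (×-homo-+) renaming (_×_ to infixr 8 _⋆_)
  open GroupProperties +-group using (identityʳ-unique)
  open SetoidReasoning setoid

  0≤⋆ : ∀ k → 0# ≤ (k ⋆ a)
  0≤⋆ zero    = ≤-refl
  0≤⋆ (suc k) = ≤-trans (0≤⋆ k) (≤-resp-≈ (+-identityˡ _) refl (+-mono-≤ (k ⋆ a) (proj₁ 0<a)))

  suc⋆≉0 : ∀ k → ¬ suc k ⋆ a ≈ 0#
  suc⋆≉0 k ≈0 = proj₂ 0<a (≤-antisym (proj₁ 0<a)
    (≤-resp-≈ (+-identityˡ a) (trans (+-comm (k ⋆ a) a) ≈0) (+-mono-≤ a (0≤⋆ k))))

  ⋆-cancel-< : ∀ {k l} → k ℕ.< l → ¬ k ⋆ a ≈ l ⋆ a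
  ⋆-cancel-< {k} {l} k<l eq with ℕ.m≤n⇒∃[o]m+o≡n k<l
  ... | d , ≡.refl = suc⋆≉0 d (identityʳ-unique (k ⋆ a) (suc d ⋆ a) (begin
    k ⋆ a + suc d ⋆ a   ≈⟨ ×-homo-+ a k (suc d) ⟨
    (k ℕ.+ suc d) ⋆ a   ≡⟨ ≡.cong (_⋆ a) (ℕ.+-suc k d) ⟩
    suc (k ℕ.+ d) ⋆ a   ≈⟨ eq ⟨
    k ⋆ a ∎))

  ⋆-injective : ∀ k l → k ⋆ a ≈ l ⋆ a → k ≡ l
  ⋆-injective k l eq with ℕ.<-cmp k l
  ... | tri< k<l _ _ = ⊥-elim (⋆-cancel-< k<l eq)
  ... | tri≈ _ k≡l _ = k≡l
  ... | tri> _ _ l<k = ⊥-elim (⋆-cancel-< l<k (sym eq))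

  +-cancel : ∀ x {y z} → x + y ≈ x + z → y ≈ z
  +-cancel x {y} {z} = GroupProperties.∙-cancelˡ +-group x y z

  shift : ∀ x k l → x + (k ℕ.+ l) ⋆ a ≈ (x + k ⋆ a) + l ⋆ a
  shift x k l = trans (+-congˡ (×-homo-+ a k l)) (sym (+-assoc x _ _))

  swap : ∀ x y z → (x + y) + z ≈ (x + z) + y
  swap x y z = trans (+-assoc x y z) (trans (+-congˡ (+-comm y z)) (sym (+-assoc x z y)))

  -- N bounds the multiples of a that can occur, so no Archimedean floor is needed.
  Ranked : ∀ {n} → (Fin n → Carrier) → ℕ → (Fin n → ℤ) → Set
  Ranked B N b = ∀ u v k l → k ℕ.≤ N → l ℕ.≤ N → B u + k ⋆ a ≈ B v + l ⋆ a → b u ℤ.+ + k ≡ b v ℤ.+ + l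

  abstract

    -- The tail is ranked with the doubled bound: two relations through the first vertex compose.
    ranking : ∀ {n} (B : Fin n → Carrier) N → Σ (Fin n → ℤ) (Ranked B N)
    ranking {zero} B N = (λ ()) , λ ()
    ranking {suc n} B N with ranking (λ v → B (suc v)) (N ℕ.+ N)
      | any? (λ u → any? λ (k : Fin (suc N)) → any? λ (l : Fin (suc N)) → (B zero + toℕ k ⋆ a) ≈? (B (suc u) + toℕ l ⋆ a))
    ... | b , ranked | no ¬found = b′ , ranked′
      where
      -- No relation within the bound involves the first vertex, so its integer base is arbitrary; 0
      -- is taken.
      b′ : Fin (suc n) → ℤ
      b′ zero    = 0ℤ
      b′ (suc v) = b v
      absurd : ∀ v k l → k ℕ.≤ N → l ℕ.≤ N → ¬ B zero + k ⋆ a ≈ B (suc v) + l ⋆ a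
      absurd v k l k≤ l≤ eq = ¬found (v , fromℕ< (s≤s k≤) , fromℕ< (s≤s l≤) ,
        ≡.subst₂ (λ p q → B zero + p ⋆ a ≈ B (suc v) + q ⋆ a) (≡.sym (toℕ-fromℕ< (s≤s k≤))) (≡.sym (toℕ-fromℕ< (s≤s l≤))) eq)
      ranked′ : Ranked B N b′
      ranked′ zero    zero    k l _  _  eq = ≡.cong (λ z → 0ℤ ℤ.+ + z) (⋆-injective k l (+-cancel (B zero) eq))
      ranked′ zero    (suc v) k l k≤ l≤ eq = ⊥-elim (absurd v k l k≤ l≤ eq)
      ranked′ (suc u) zero    k l k≤ l≤ eq = ⊥-elim (absurd u l k l≤ k≤ (sym eq))
      ranked′ (suc u) (suc v) k l k≤ l≤ eq = ranked u v k l (ℕ.≤-trans k≤ (ℕ.m≤m+n N N)) (ℕ.≤-trans l≤ (ℕ.m≤m+n N N)) eq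
    ... | b , ranked | yes (u , k₀′ , l₀′ , eq₀) = b′ , ranked′
      where
      k₀ l₀ : ℕ
      k₀ = toℕ k₀′
      l₀ = toℕ l₀′
      k₀≤ : k₀ ℕ.≤ N
      k₀≤ = ℕ.≤-pred (toℕ<n k₀′)
      l₀≤ : l₀ ℕ.≤ N
      l₀≤ = ℕ.≤-pred (toℕ<n l₀′)
      -- The relation `eq₀` between the first vertex and `u` forces the value at the first vertex.
      b′ : Fin (suc n) → ℤ
      b′ zero    = (b u ℤ.+ + l₀) ℤ.- + k₀
      b′ (suc v) = b v
      rearrange : ∀ p q r s x y → p ℤ.+ (q ℤ.+ r) ≡ s ℤ.+ (x ℤ.+ y) → ((p ℤ.+ q) ℤ.- y) ℤ.+ r ≡ s ℤ.+ x
      rearrange p q r s x y eq = ≡.trans (lem p q r y) (≡.trans (≡.cong (ℤ._- y) eq) (lem′ s x y))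
        where
        lem : ∀ p q r y → ((p ℤ.+ q) ℤ.- y) ℤ.+ r ≡ (p ℤ.+ (q ℤ.+ r)) ℤ.- y
        lem = solve-∀
        lem′ : ∀ s x y → (s ℤ.+ (x ℤ.+ y)) ℤ.- y ≡ s ℤ.+ x
        lem′ = solve-∀
      via-u : ∀ v k l → k ℕ.≤ N → l ℕ.≤ N → B zero + k ⋆ a ≈ B (suc v) + l ⋆ a → b′ zero ℤ.+ + k ≡ b v ℤ.+ + l
      via-u v k l k≤ l≤ eq = rearrange (b u) (+ l₀) (+ k) (b v) (+ l) (+ k₀)
        (ranked u v (l₀ ℕ.+ k) (l ℕ.+ k₀) (ℕ.+-mono-≤ l₀≤ k≤) (ℕ.+-mono-≤ l≤ k₀≤) (begin
          B (suc u) + (l₀ ℕ.+ k) ⋆ a     ≈⟨ shift (B (suc u)) l₀ k ⟩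
          (B (suc u) + l₀ ⋆ a) + k ⋆ a   ≈⟨ +-congʳ eq₀ ⟨
          (B zero + k₀ ⋆ a) + k ⋆ a      ≈⟨ swap (B zero) (k₀ ⋆ a) (k ⋆ a) ⟩
          (B zero + k ⋆ a) + k₀ ⋆ a      ≈⟨ +-congʳ eq ⟩
          (B (suc v) + l ⋆ a) + k₀ ⋆ a   ≈⟨ shift (B (suc v)) l k₀ ⟨
          B (suc v) + (l ℕ.+ k₀) ⋆ a ∎))
      ranked′ : Ranked B N b′
      ranked′ zero    zero    k l _  _  eq = ≡.cong (λ z → b′ zero ℤ.+ + z) (⋆-injective k l (+-cancel (B zero) eq))
      ranked′ zero    (suc v) k l k≤ l≤ eq = via-u v k l k≤ l≤ eq
      ranked′ (suc v) zero    k l k≤ l≤ eq = ≡.sym (via-u v l k l≤ k≤ (sym eq))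
      ranked′ (suc v) (suc w) k l k≤ l≤ eq = ranked v w k l (ℕ.≤-trans k≤ (ℕ.m≤m+n N N)) (ℕ.≤-trans l≤ (ℕ.m≤m+n N N)) eq

  module Weighting (G : SimpleGraph) (c : SimpleGraph.Element G → Carrier) where

    open SimpleGraph G

    end₁ end₂ : Fin m → Fin n
    end₁ e = proj₁ (endpoints e)
    end₂ e = proj₂ (endpoints e)

    -- The weighted degrees when every element takes its smaller list value; choosing bits then adds
    -- multiples of `a`.
    B : Fin n → Carrier
    B = σ ℝ G c

    b : Fin n → ℤ
    -- At most `m` edges and the vertex itself can each add one `a`, whence the bound `suc m`.
    b = proj₁ (ranking B (suc m))

    y : Fin m → Bool
    y = proj₁ (integer-weighting end₁ end₂ loopless b)

    x : Fin n → Bool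
    x = proj₁ (proj₂ (integer-weighting end₁ end₂ loopless b))

    chosen : Element → Bool
    chosen (inj₁ v) = x v
    chosen (inj₂ e) = y e

    w : Element → Carrier
    w z = c z + bitℕ (chosen z) ⋆ a

    w∈L : ∀ z → (w z ≈ c z) ⊎ (w z ≈ c z + a)
    w∈L z with chosen z
    ... | false = inj₁ (+-identityʳ (c z))
    ... | true  = inj₂ (+-congˡ (+-identityʳ a))

    -- The case split follows that of `incidentWeight`, so that one case analysis reduces both in
    -- `incident-load`.
    load : Fin n → Fin m → ℕ
    load v e with v ≟ end₁ e | v ≟ end₂ e
    ... | yes _ | _     = bitℕ (y e)
    ... | no _  | yes _ = bitℕ (y e)
    ... | no _  | no _  = 0

    load≤1 : ∀ v e → load v e ℕ.≤ 1
    load≤1 v e with v ≟ end₁ e | v ≟ end₂ e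
    ... | yes _ | _     = bitℕ≤1 (y e)
    ... | no _  | yes _ = bitℕ≤1 (y e)
    ... | no _  | no _  = z≤n

    -- At a loop the two `δ` terms would add up to 2 while `load` counts the edge once; looplessness
    -- rules this out.
    load-δ : ∀ v e → + load v e ≡ 𝟙 (y e) ℤ.* (δ (end₁ e) v ℤ.+ δ (end₂ e) v)
    load-δ v e with v ≟ end₁ e | v ≟ end₂ e
    ... | yes p | yes q = contradiction (≡.trans (≡.sym p) q) (loopless e)
    ... | yes ≡.refl | no q = ≡.trans (+bitℕ (y e)) (≡.sym (≡.trans
      (≡.cong (ℤ._*_ (𝟙 (y e))) (≡.cong₂ ℤ._+_ (δ-refl v) (δ-≢ (λ r → q (≡.sym r))))) (ℤ.*-identityʳ _)))
    ... | no p | yes ≡.refl = ≡.trans (+bitℕ (y e)) (≡.sym (≡.trans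
      (≡.cong (ℤ._*_ (𝟙 (y e))) (≡.cong₂ ℤ._+_ (δ-≢ (λ r → p (≡.sym r))) (δ-refl v))) (ℤ.*-identityʳ _)))
    ... | no p | no q = ≡.sym (≡.trans
      (≡.cong (ℤ._*_ (𝟙 (y e))) (≡.cong₂ ℤ._+_ (δ-≢ (λ r → p (≡.sym r))) (δ-≢ (λ r → q (≡.sym r))))) (ℤ.*-zeroʳ (𝟙 (y e))))

    incident-load : ∀ v e → incidentWeight ℝ G w v e ≈ incidentWeight ℝ G c v e + load v e ⋆ a
    incident-load v e with v ≟ end₁ e | v ≟ end₂ e
    ... | yes _ | _     = refl
    ... | no _  | yes _ = refl
    ... | no _  | no _  = sym (+-identityʳ 0#)

    sumFin-load : ∀ {k} (f g : Fin k → Carrier) (κ : Fin k → ℕ) → (∀ i → f i ≈ g i + κ i ⋆ a) →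
                  sumFin ℝ G f ≈ sumFin ℝ G g + sumℕ κ ⋆ a
    sumFin-load {zero} f g κ eq = sym (+-identityʳ 0#)
    sumFin-load {suc k} f g κ eq = begin
      f zero + F                                     ≈⟨ +-cong (eq zero) (sumFin-load _ _ (λ i → κ (suc i)) (λ i → eq (suc i))) ⟩
      (g zero + κ₀) + (G′ + K)                       ≈⟨ interchange (g zero) κ₀ G′ K ⟩
      (g zero + G′) + (κ₀ + K)                       ≈⟨ +-congˡ (×-homo-+ a (κ zero) (sumℕ (λ i → κ (suc i)))) ⟨
      (g zero + G′) + (κ zero ℕ.+ sumℕ (λ i → κ (suc i))) ⋆ a ∎
      where
      F G′ κ₀ K : Carrier
      F  = sumFin ℝ G (λ i → f (suc i))
      G′ = sumFin ℝ G (λ i → g (suc i))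
      κ₀ = κ zero ⋆ a
      K  = sumℕ (λ i → κ (suc i)) ⋆ a
      interchange : ∀ p q r s → (p + q) + (r + s) ≈ (p + r) + (q + s)
      interchange p q r s = trans (sym (+-assoc (p + q) r s)) (trans (+-congʳ (swap p q r)) (+-assoc (p + r) q s))

    total : Fin n → ℕ
    total v = bitℕ (x v) ℕ.+ sumℕ (load v)

    total≤ : ∀ v → total v ℕ.≤ suc m
    total≤ v = ℕ.+-mono-≤ (bitℕ≤1 (x v)) (sumℕ≤ (load v) (load≤1 v))

    σ-total : ∀ v → σ ℝ G w v ≈ B v + total v ⋆ a
    σ-total v = begin
      (cv + xa) + sumFin ℝ G (incidentWeight ℝ G w v)   ≈⟨ +-congˡ (sumFin-load _ _ (load v) (incident-load v)) ⟩
      (cv + xa) + (C + L)                               ≈⟨ +-assoc (cv + xa) C L ⟨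
      ((cv + xa) + C) + L                               ≈⟨ +-congʳ (swap cv xa C) ⟩
      ((cv + C) + xa) + L                               ≈⟨ shift (cv + C) (bitℕ (x v)) (sumℕ (load v)) ⟨
      (cv + C) + total v ⋆ a ∎
      where
      cv xa C L : Carrier
      cv = c (inj₁ v)
      xa = bitℕ (x v) ⋆ a
      C = sumFin ℝ G (incidentWeight ℝ G c v)
      L = sumℕ (load v) ⋆ a

    integer-total : ∀ v → b v ℤ.+ + total v ≡ b v ℤ.+ 𝟙 (x v) ℤ.+ sum (λ e → 𝟙 (y e) ℤ.* (δ (end₁ e) v ℤ.+ δ (end₂ e) v))
    integer-total v = ≡.trans (≡.cong (ℤ._+_ (b v)) (≡.cong₂ ℤ._+_ (+bitℕ (x v)) (≡.trans (+sumℕ (load v)) (sum-cong-≗ (load-δ v)))))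
                              (≡.sym (ℤ.+-assoc (b v) (𝟙 (x v)) _))

    -- Equal real degrees along an edge form a relation with at most `suc m` multiples of `a` on
    -- each side. The ranking turns it into equality of the integer totals, which
    -- `integer-weighting` forbids.
    proper : Proper ℝ G w
    proper e eq = proj₂ (proj₂ (integer-weighting end₁ end₂ loopless b)) e
      (≡.trans (≡.sym (integer-total (end₁ e))) (≡.trans
        (proj₂ (ranking B (suc m)) (end₁ e) (end₂ e) (total (end₁ e)) (total (end₂ e)) (total≤ (end₁ e)) (total≤ (end₂ e))
          (trans (sym (σ-total (end₁ e))) (trans eq (σ-total (end₂ e)))))
        (integer-total (end₂ e))))

theorem1 : (ℝ : RealNumbers) (G : SimpleGraph) →
    let open RealNumbers ℝ
        open SimpleGraph G
    in (a : Carrier) → 0# < a → (c : Element → Carrier) →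
       Σ (Element → Carrier) λ w →
         (∀ z → (w z ≈ c z) ⊎ (w z ≈ c z + a)) × Proper ℝ G w
theorem1 ℝ G a 0<a c = w , w∈L , proper
  where open Reals.Weighting ℝ a 0<a G c
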